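{- Let $\Gamma$, the new edge $\mathcal{E}$ and the spine $\mathcal{S}=\Gamma+\mathcal{E}$ be as specified in the context, and suppose the endpoints of $\mathcal{E}$ lie in two different connected components of $\Gamma$ (edge attachment). (1) If $\mathcal{E}$ connects two distinct stacked components, then $$\mathrm{MeanDiam}(\mathcal{S})=\frac{(\mathrm{ord}(\ell)+3)(h(-p)+\mathrm{ord}(\ell))}{2(h(-p)-\mathrm{ord}(\ell))}.$$ (2) If $\mathcal{E}$ connects the folded component to a stacked component, then $$\frac{h(-p)\,\mathrm{ord}(\ell)+3h(-p)+6\,\mathrm{ord}(\ell)}{2(h(-p)-\mathrm{ord}(\ell))}\ \le\ \mathrm{MeanDiam}(\mathcal{S})\ \le\ \frac{(\mathrm{ord}(\ell)+3)(h(-p)+\mathrm{ord}(\ell))}{2(h(-p)-\mathrm{ord}(\ell))}.$$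
   Context: Let $p$ be a prime with $p\equiv 71$ or $119\pmod{120}$ and $\ell=2$. Let $h(-p)$ be the class number of $\mathbb{Q}(\sqrt{ -p})$ (it is odd) and let $L=\mathrm{ord}(\ell)$ be the order in the class group of a prime ideal above $2$; $L$ is an odd integer $\ge3$ dividing $h(-p)$. The graph $\Gamma$ (the supersingular $2$-isogeny graph over $\mathbb{F}_p$ after identifying curves and isogenies up to $\overline{\mathbb{F}_p}$-equivalence, regarded as a simple undirected graph) is the disjoint union of one folded component $\mathcal{F}$ and $\frac12\left(\frac{h(-p)}{L}-1\right)$ stacked components, each a copy of $\mathcal{T}$, where $V(\mathcal{F})=\{0,\dots,L-1\}$, $E(\mathcal{F})=\{\{2k-1,2k+1\}: 1\le k\le \tfrac12(L-3)\}\cup\{\{2k+1,2k+2\}:0\le k\le \tfrac12(L-3)\}\cup\{\{0,1\}\}$, and $V(\mathcal{T})=\{0,\dots,2L-1\}$, $E(\mathcal{T})=\{\{2i,2i+1\}:0\le i\le L-1\}\cup\{\{2i+1,2i+3\}:0\le i\le L-2\}\cup\{\{2L-1,1\}\}$. Floor vertices are the nonzero even vertices of $\mathcal{F}$ and all even vertices of the stacked components. The spine $\mathcal{S}$ is obtained from $\Gamma$ by adding a single new edge $\mathcal{E}$ (coming from $2$-isogenies not defined over $\mathbb{F}_p$), whose endpoints are two distinct floor vertices; it is treated here as an arbitrary such edge. For a graph with connected components $C_1,\dots,C_m$, $\mathrm{MeanDiam}$ is $\frac1m\sum_{i=1}^m\mathrm{diam}(C_i)$. -}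

module Defs where

open import Algebra.Bundles using (CommutativeRing; AbelianGroup)
import Algebra.Construct.DirectProduct as DirectProduct
open import Data.Empty using (⊥-elim)
open import Data.Fin using (Fin; toℕ)
open import Data.Integer as ℤ using (ℤ; +_)
import Data.Integer.Properties as ℤ
open import Data.Integer.Tactic.RingSolver using (solve-∀)
open import Data.List using (List; []; _∷_; [_]; map; cartesianProductWith; tabulate)
open import Data.Nat using (ℕ; zero; suc; _+_; _*_; _∸_; _≤_; _<_; _≤?_; NonZero; >-nonZero)
open import Data.Nat.Divisibility using (_∣_)
open import Data.Nat.DivMod using (_/_; /-monoˡ-≤; n/n≡1; /-congˡ)
open import Data.Nat.ListAction using (sum)
open import Data.Nat.Properties using (m≤n⇒m∸n≡0; m*n≢0; m<n⇒0<n∸m; ≰⇒>)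
open import Data.Product using (Σ; ∃-syntax; _×_; _,_)
import Data.Product.Relation.Binary.Pointwise.NonDependent as ×
open import Data.Rational as ℚ using (ℚ)
open import Data.Sum using (_⊎_; inj₁; inj₂)
import Data.Sum.Relation.Binary.Pointwise as ⊎
open import Function using (_on_; _⇔_)
open import Function.Definitions using (Surjective)
open import Level using (Lift; 0ℓ) renaming (_⊔_ to _⊔ˡ_)
open import Relation.Binary.Construct.Closure.Symmetric as Sym using (SymClosure)
open import Relation.Binary.Core using (Rel)
open import Relation.Binary.Definitions using (Symmetric; Irreflexive)
open import Relation.Binary.PropositionalEquality using (_≡_; _≢_; refl; sym; trans; subst)
open import Relation.Nullary using (¬_; yes; no)

-- Ideals are given by finite lists of generators, which loses nothing over
-- a Noetherian ring such as a ring of integers.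
module Ideals {c ℓ} (R : CommutativeRing c ℓ) where
  open CommutativeRing R using (Carrier; _≈_; 0#; 1#)
    renaming (_+_ to _+ᴿ_; _*_ to _*ᴿ_)

  Ideal : Set c
  Ideal = List Carrier

  infix 4 _∈_ _⊆_ _≐_ _∼_

  _∈_ : Carrier → Ideal → Set (c ⊔ˡ ℓ)
  x ∈ []       = Lift (c ⊔ˡ ℓ) (x ≈ 0#)
  x ∈ (g ∷ gs) = ∃[ r ] ∃[ y ] (y ∈ gs × x ≈ (r *ᴿ g) +ᴿ y)

  _⊆_ _≐_ : Ideal → Ideal → Set (c ⊔ˡ ℓ)
  I ⊆ J = ∀ x → x ∈ I → x ∈ J
  I ≐ J = I ⊆ J × J ⊆ I

  NonzeroIdeal : Ideal → Set (c ⊔ˡ ℓ)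
  NonzeroIdeal I = ∃[ x ] (x ∈ I × ¬ x ≈ 0#)

  IsPrimeIdeal : Ideal → Set (c ⊔ˡ ℓ)
  IsPrimeIdeal I = ¬ 1# ∈ I × (∀ x y → x *ᴿ y ∈ I → x ∈ I ⊎ y ∈ I)

  _·_ : Ideal → Ideal → Ideal
  _·_ = cartesianProductWith _*ᴿ_

  _^ᴵ_ : Ideal → ℕ → Ideal
  I ^ᴵ zero  = [ 1# ]
  I ^ᴵ suc n = I · (I ^ᴵ n)

  -- I and J have the same class: a I = b J for some nonzero a, b.
  _∼_ : Ideal → Ideal → Set (c ⊔ˡ ℓ)
  I ∼ J = ∃[ a ] ∃[ b ] (¬ a ≈ 0# × ¬ b ≈ 0# × map (a *ᴿ_) I ≐ map (b *ᴿ_) J)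

  record HasClassNumber (h : ℕ) : Set (c ⊔ˡ ℓ) where
    field
      rep          : Fin h → Ideal
      rep-nonzero  : ∀ i → NonzeroIdeal (rep i)
      rep-complete : ∀ I → NonzeroIdeal I → ∃[ i ] I ∼ rep i
      rep-distinct : ∀ i j → rep i ∼ rep j → i ≡ j

  HasClassOrder : Ideal → ℕ → Set (c ⊔ˡ ℓ)
  HasClassOrder I n =
    0 < n × (I ^ᴵ n) ∼ [ 1# ] × (∀ k → 0 < k → k < n → ¬ (I ^ᴵ k) ∼ [ 1# ])

-- For a prime p ≡ 3 (mod 4) the ring of integers of ℚ(√-p) is ℤ[ω] with
-- ω = (1 + √-p)/2, and ω² = ω - (p + 1)/4.  The pair (a , b) stands for a + b ω.
module RingOfIntegers (p : ℕ) where
  private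
    ℤ² : AbelianGroup 0ℓ 0ℓ
    ℤ² = DirectProduct.abelianGroup ℤ.+-0-abelianGroup ℤ.+-0-abelianGroup

    module ℤ² = AbelianGroup ℤ²

    mul : ℤ → ℤ × ℤ → ℤ × ℤ → ℤ × ℤ
    mul n (a , b) (c , d) =
      (a ℤ.* c ℤ.- n ℤ.* (b ℤ.* d)) , (a ℤ.* d ℤ.+ b ℤ.* c ℤ.+ b ℤ.* d)

  normω : ℤ
  normω = + (suc p / 4)

  _⊛_ : ℤ × ℤ → ℤ × ℤ → ℤ × ℤ
  _⊛_ = mul normω

  private
    assoc₁ : ∀ n a b c d e f →
      (a ℤ.* c ℤ.- n ℤ.* (b ℤ.* d)) ℤ.* e ℤ.- n ℤ.* ((a ℤ.* d ℤ.+ b ℤ.* c ℤ.+ b ℤ.* d) ℤ.* f) ≡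
      a ℤ.* (c ℤ.* e ℤ.- n ℤ.* (d ℤ.* f)) ℤ.- n ℤ.* (b ℤ.* (c ℤ.* f ℤ.+ d ℤ.* e ℤ.+ d ℤ.* f))
    assoc₁ = solve-∀

    assoc₂ : ∀ n a b c d e f →
      (a ℤ.* c ℤ.- n ℤ.* (b ℤ.* d)) ℤ.* f ℤ.+ (a ℤ.* d ℤ.+ b ℤ.* c ℤ.+ b ℤ.* d) ℤ.* e
        ℤ.+ (a ℤ.* d ℤ.+ b ℤ.* c ℤ.+ b ℤ.* d) ℤ.* f ≡
      a ℤ.* (c ℤ.* f ℤ.+ d ℤ.* e ℤ.+ d ℤ.* f) ℤ.+ b ℤ.* (c ℤ.* e ℤ.- n ℤ.* (d ℤ.* f))
        ℤ.+ b ℤ.* (c ℤ.* f ℤ.+ d ℤ.* e ℤ.+ d ℤ.* f)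
    assoc₂ = solve-∀

    comm₁ : ∀ n a b c d → a ℤ.* c ℤ.- n ℤ.* (b ℤ.* d) ≡ c ℤ.* a ℤ.- n ℤ.* (d ℤ.* b)
    comm₁ = solve-∀

    comm₂ : ∀ a b c d → a ℤ.* d ℤ.+ b ℤ.* c ℤ.+ b ℤ.* d ≡ c ℤ.* b ℤ.+ d ℤ.* a ℤ.+ d ℤ.* b
    comm₂ = solve-∀

    idˡ₁ : ∀ n c d → + 1 ℤ.* c ℤ.- n ℤ.* (+ 0 ℤ.* d) ≡ c
    idˡ₁ = solve-∀

    idˡ₂ : ∀ c d → + 1 ℤ.* d ℤ.+ + 0 ℤ.* c ℤ.+ + 0 ℤ.* d ≡ d
    idˡ₂ = solve-∀

    idʳ₁ : ∀ n a b → a ℤ.* + 1 ℤ.- n ℤ.* (b ℤ.* + 0) ≡ a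
    idʳ₁ = solve-∀

    idʳ₂ : ∀ a b → a ℤ.* + 0 ℤ.+ b ℤ.* + 1 ℤ.+ b ℤ.* + 0 ≡ b
    idʳ₂ = solve-∀

    distribˡ₁ : ∀ n a b c d e f →
      a ℤ.* (c ℤ.+ e) ℤ.- n ℤ.* (b ℤ.* (d ℤ.+ f)) ≡
      (a ℤ.* c ℤ.- n ℤ.* (b ℤ.* d)) ℤ.+ (a ℤ.* e ℤ.- n ℤ.* (b ℤ.* f))
    distribˡ₁ = solve-∀

    distribˡ₂ : ∀ a b c d e f →
      a ℤ.* (d ℤ.+ f) ℤ.+ b ℤ.* (c ℤ.+ e) ℤ.+ b ℤ.* (d ℤ.+ f) ≡
      (a ℤ.* d ℤ.+ b ℤ.* c ℤ.+ b ℤ.* d) ℤ.+ (a ℤ.* f ℤ.+ b ℤ.* e ℤ.+ b ℤ.* f)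
    distribˡ₂ = solve-∀

    distribʳ₁ : ∀ n a b c d e f →
      (c ℤ.+ e) ℤ.* a ℤ.- n ℤ.* ((d ℤ.+ f) ℤ.* b) ≡
      (c ℤ.* a ℤ.- n ℤ.* (d ℤ.* b)) ℤ.+ (e ℤ.* a ℤ.- n ℤ.* (f ℤ.* b))
    distribʳ₁ = solve-∀

    distribʳ₂ : ∀ a b c d e f →
      (c ℤ.+ e) ℤ.* b ℤ.+ (d ℤ.+ f) ℤ.* a ℤ.+ (d ℤ.+ f) ℤ.* b ≡
      (c ℤ.* b ℤ.+ d ℤ.* a ℤ.+ d ℤ.* b) ℤ.+ (e ℤ.* b ℤ.+ f ℤ.* a ℤ.+ f ℤ.* b)
    distribʳ₂ = solve-∀

  commutativeRing : CommutativeRing 0ℓ 0ℓ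
  commutativeRing = record
    { Carrier = ℤ × ℤ
    ; _≈_     = ℤ²._≈_
    ; _+_     = ℤ²._∙_
    ; _*_     = _⊛_
    ; -_      = ℤ²._⁻¹
    ; 0#      = ℤ².ε
    ; 1#      = + 1 , + 0
    ; isCommutativeRing = record
      { isRing = record
        { +-isAbelianGroup = ℤ².isAbelianGroup
        ; *-cong = λ { (refl , refl) (refl , refl) → refl , refl }
        ; *-assoc = λ { (a , b) (c , d) (e , f) →
            assoc₁ normω a b c d e f , assoc₂ normω a b c d e f }
        ; *-identity =
            (λ { (c , d) → idˡ₁ normω c d , idˡ₂ c d }) ,
            (λ { (a , b) → idʳ₁ normω a b , idʳ₂ a b })
        ; distrib =
            (λ { (a , b) (c , d) (e , f) →
              distribˡ₁ normω a b c d e f , distribˡ₂ a b c d e f }) ,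
            (λ { (a , b) (c , d) (e , f) →
              distribʳ₁ normω a b c d e f , distribʳ₂ a b c d e f })
        }
      ; *-comm = λ { (a , b) (c , d) → comm₁ normω a b c d , comm₂ a b c d }
      }
    }

module 𝓞 (p : ℕ) = Ideals (RingOfIntegers.commutativeRing p)

IsClassNumber : ℕ → ℕ → Set
IsClassNumber p h = 𝓞.HasClassNumber p h

-- L is the order of the class of a prime ideal above 2; the primes above 2
-- are conjugate, so the choice of prime ideal is immaterial.
IsOrderOfPrimeAbove2 : ℕ → ℕ → Set
IsOrderOfPrimeAbove2 p L =
  ∃[ 𝔭 ] (IsPrimeIdeal 𝔭 × (+ 2 , + 0) ∈ 𝔭 × HasClassOrder 𝔭 L)
  where open 𝓞 p

record Graph : Set₁ where
  field
    Vertex : Set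
    Adj    : Rel Vertex 0ℓ
    symm   : Symmetric Adj
    irrefl : Irreflexive _≡_ Adj

open Graph public using (Vertex; Adj)

data Walk (G : Graph) : ℕ → Rel (Vertex G) 0ℓ where
  []  : ∀ {u} → Walk G 0 u u
  _∷_ : ∀ {n u v w} → Adj G u v → Walk G n v w → Walk G (suc n) u w

Connected : (G : Graph) → Rel (Vertex G) 0ℓ
Connected G u v = ∃[ n ] Walk G n u v

IsDist : (G : Graph) → Vertex G → Vertex G → ℕ → Set
IsDist G u v d = Walk G d u v × (∀ n → Walk G n u v → d ≤ n)

-- Used only for C a connected component, where distances within C and
-- within G agree.
IsDiam : (G : Graph) → (Vertex G → Set) → ℕ → Set
IsDiam G C d =
  (∃[ u ] ∃[ v ] (C u × C v × IsDist G u v d)) ×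
  (∀ u v → C u → C v → ∀ n → IsDist G u v n → n ≤ d)

record Components (G : Graph) (m : ℕ) : Set where
  field
    comp       : Vertex G → Fin m
    surjective : Surjective _≡_ _≡_ comp
    connected  : ∀ u v → (comp u ≡ comp v) ⇔ Connected G u v

IsMeanDiam : Graph → ℚ → Set
IsMeanDiam G q =
  Σ ℕ λ m → Σ (NonZero m) λ nz → Σ (Components G m) λ C → Σ (Fin m → ℕ) λ diam →
    (∀ i → IsDiam G (λ v → Components.comp C v ≡ i) (diam i)) ×
    q ≡ ((+ sum (tabulate diam)) ℚ./ m) {{nz}}

-- The simple graph on {0,…,n-1} whose edges are the {a , b} with E a b;
-- the condition x ≢ y discards loops.
fromEdges : (n : ℕ) → Rel ℕ 0ℓ → Graph
fromEdges n E = record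
  { Vertex = Fin n
  ; Adj    = λ x y → x ≢ y × SymClosure (E on toℕ) x y
  ; symm   = λ { (x≢y , e) → (λ y≡x → x≢y (sym y≡x)) , Sym.symmetric (E on toℕ) e }
  ; irrefl = λ { x≡y (x≢y , _) → x≢y x≡y }
  }

_⊎ᴳ_ : Graph → Graph → Graph
G ⊎ᴳ H = record
  { Vertex = Vertex G ⊎ Vertex H
  ; Adj    = ⊎.Pointwise (Adj G) (Adj H)
  ; symm   = ⊎.⊎-symmetric (Graph.symm G) (Graph.symm H)
  ; irrefl = λ { refl (⊎.inj₁ e) → Graph.irrefl G refl e
               ; refl (⊎.inj₂ e) → Graph.irrefl H refl e }
  }

copies : ℕ → Graph → Graph
copies n G = record
  { Vertex = Fin n × Vertex G
  ; Adj    = ×.Pointwise _≡_ (Adj G)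
  ; symm   = ×.×-symmetric {R = _≡_} {S = Adj G} sym (Graph.symm G)
  ; irrefl = λ { refl (_ , e) → Graph.irrefl G refl e }
  }

addEdge : (G : Graph) (u v : Vertex G) → u ≢ v → Graph
addEdge G u v u≢v = record
  { Vertex = Vertex G
  ; Adj    = λ x y → Adj G x y ⊎ ((x ≡ u × y ≡ v) ⊎ (x ≡ v × y ≡ u))
  ; symm   = λ { (inj₁ e)              → inj₁ (Graph.symm G e)
               ; (inj₂ (inj₁ (p , q))) → inj₂ (inj₂ (q , p))
               ; (inj₂ (inj₂ (p , q))) → inj₂ (inj₁ (q , p)) }
  ; irrefl = λ { x≡y  (inj₁ e)                    → Graph.irrefl G x≡y e
               ; refl (inj₂ (inj₁ (x≡u , x≡v))) → u≢v (trans (sym x≡u) x≡v)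
               ; refl (inj₂ (inj₂ (x≡v , x≡u))) → u≢v (trans (sym x≡u) x≡v) }
  }

data FoldedEdge (L : ℕ) : Rel ℕ 0ℓ where
  surface  : ∀ k → 1 ≤ k → k ≤ (L ∸ 3) / 2 → FoldedEdge L (2 * k ∸ 1) (2 * k + 1)
  vertical : ∀ k → k ≤ (L ∸ 3) / 2 → FoldedEdge L (2 * k + 1) (2 * k + 2)
  fold     : FoldedEdge L 0 1

data StackedEdge (L : ℕ) : Rel ℕ 0ℓ where
  vertical : ∀ i → i ≤ L ∸ 1 → StackedEdge L (2 * i) (2 * i + 1)
  surface  : ∀ i → i ≤ L ∸ 2 → StackedEdge L (2 * i + 1) (2 * i + 3)
  closing  : StackedEdge L (2 * L ∸ 1) 1

𝓕 𝓣 : ℕ → Graph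
𝓕 L = fromEdges L (FoldedEdge L)
𝓣 L = fromEdges (2 * L) (StackedEdge L)

stackedCount : (h L : ℕ) .{{_ : NonZero L}} → ℕ
stackedCount h L = (h / L ∸ 1) / 2

Γ : (h L : ℕ) .{{_ : NonZero L}} → Graph
Γ h L = 𝓕 L ⊎ᴳ copies (stackedCount h L) (𝓣 L)

module _ {h L : ℕ} .{{_ : NonZero L}} where

  data InFolded : Vertex (Γ h L) → Set where
    folded : ∀ x → InFolded (inj₁ x)

  data InStacked (i : Fin (stackedCount h L)) : Vertex (Γ h L) → Set where
    stacked : ∀ x → InStacked i (inj₂ (i , x))

  data Floor : Vertex (Γ h L) → Set where
    folded  : ∀ {x} → toℕ x ≢ 0 → 2 ∣ toℕ x → Floor (inj₁ x)
    stacked : ∀ {i x} → 2 ∣ toℕ x → Floor (inj₂ (i , x))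

-- The denominator 2 (h - L) is nonzero once there is a stacked component.
stacked⇒nonZero : ∀ h L .{{_ : NonZero L}} → Fin (stackedCount h L) → NonZero (2 * (h ∸ L))
stacked⇒nonZero h L i with h ≤? L
... | yes h≤L = ⊥-elim (noFin (subst Fin count≡0 i))
  where
  noFin : ¬ Fin 0
  noFin ()
  h/L≤1 : h / L ≤ 1
  h/L≤1 = subst (h / L ≤_) (n/n≡1 L) (/-monoˡ-≤ L h≤L)
  count≡0 : stackedCount h L ≡ 0
  count≡0 = /-congˡ {o = 2} (m≤n⇒m∸n≡0 h/L≤1)
... | no h≰L = m*n≢0 2 (h ∸ L) {{_}} {{>-nonZero (m<n⇒0<n∸m (≰⇒> h≰L))}}

spine : (h L : ℕ) .{{_ : NonZero L}} (u v : Vertex (Γ h L)) → u ≢ v → Graph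
spine h L = addEdge (Γ h L)

upperValue lowerValue : (h L : ℕ) .{{_ : NonZero (2 * (h ∸ L))}} → ℚ
upperValue h L = (+ ((L + 3) * (h + L))) ℚ./ (2 * (h ∸ L))
lowerValue h L = (+ (h * L + 3 * h + 6 * L)) ℚ./ (2 * (h ∸ L))

{-# OPTIONS --safe #-}
module Submission where

-- Write L = 2m + 3, and let n be the number of stacked components, so that
-- h = (2n + 1) L.  The folded component has diameter m + 2 and the stacked ones have
-- diameter m + 3, which is also the eccentricity of each of their floor vertices.  A
-- floor vertex of the folded component has eccentricity c + 2 with m / 2 ≤ c ≤ m.
-- Joining two components by an edge between vertices of eccentricities a and b gives a
-- component of diameter a + b + 1, this being at least both old diameters here.
-- Upper bounds on distances come from explicit walks, and lower bounds from
-- functions on the vertices that change by at most 1 along each edge.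

open import Defs
open import Data.Empty using (⊥-elim)
open import Data.Fin using (Fin; zero; suc; toℕ; fromℕ<; punchIn; punchOut) renaming (_≟_ to _≟ᶠ_)
open import Data.Fin.Properties
  using (toℕ<n; toℕ-fromℕ<; fromℕ<-toℕ; punchIn-punchOut; punchOut-punchIn;
         punchInᵢ≢i; suc-injective)
open import Data.List using (tabulate)
open import Data.List.Properties using (tabulate-cong)
open import Data.Nat
open import Data.Nat.Divisibility using (_∣_; divides)
open import Data.Nat.DivMod
open import Data.Nat.ListAction using (sum)
open import Data.Nat.Primality using (Prime)
open import Data.Nat.Properties hiding (suc-injective)
open import Data.Nat.Tactic.RingSolver using (solve-∀)
import Data.Integer as ℤ
import Data.Integer.Properties as ℤ
open import Data.Product using (_×_; ∃-syntax; _,_; proj₁; proj₂)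
open import Data.Rational as ℚ using (ℚ)
import Data.Rational.Properties as ℚ
import Data.Rational.Unnormalised as ℚᵘ
import Data.Rational.Unnormalised.Properties as ℚᵘ
open import Data.Sum using (_⊎_; inj₁; inj₂)
import Data.Sum.Relation.Binary.Pointwise as ⊎
open import Data.Unit using (⊤; tt)
open import Function using (_∘_; const; mk⇔; Equivalence)
open import Level using (0ℓ)
open import Relation.Binary.Construct.Closure.Symmetric using (fwd; bwd)
open import Relation.Binary.Core using (Rel)
open import Relation.Binary.PropositionalEquality
open import Relation.Nullary using (¬_; yes; no)

-- Walks and distances

-- The two parts differ by a symmetry. Every leaf of a stacked component sees the odd cycle in the
-- same way, so an edge between two such leaves has the same effect wherever it lands, and the mean
-- is an exact value. In the folded component a path takes the place of the cycle, and the
-- eccentricity of a leaf depends on where it hangs. The extreme `c = m`, at either end of the path,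
-- gives the same total as part (1); `c = m / 2`, in the middle and possible only for even `m`,
-- gives the lower value. The obstacle on the side of graphs is that a walk may cross the new edge
-- many times. Once repeated crossings are cut out, every question about the spine becomes one about
-- walks in the old graph, where the two ends of the edge lie in different components. The fractions
-- simplify because `h - L = 2nL` and the factor `L` divides both numerators.

infixr 5 _++ʷ_

_++ʷ_ : ∀ {G a b x y z} → Walk G a x y → Walk G b y z → Walk G (a + b) x z
[]      ++ʷ q = q
(e ∷ p) ++ʷ q = e ∷ (p ++ʷ q)

reverseʷ : ∀ {G n x y} → Walk G n x y → Walk G n y x
reverseʷ [] = []
reverseʷ {G} {suc n} {x} {y} (e ∷ p) =
  subst (λ k → Walk G k y x) (+-comm n 1) (reverseʷ p ++ʷ (Graph.symm G e ∷ []))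

Within : (G : Graph) → ℕ → Rel (Vertex G) _
Within G d x y = ∃[ n ] (n ≤ d × Walk G n x y)

module _ {G : Graph} where

  edge : ∀ {x y} → Adj G x y → Within G 1 x y
  edge e = 1 , ≤-refl , e ∷ []

  within-trans : ∀ {a b x y z} → Within G a x y → Within G b y z → Within G (a + b) x z
  within-trans (_ , m≤a , p) (_ , n≤b , q) = _ , +-mono-≤ m≤a n≤b , p ++ʷ q

  within-sym : ∀ {a x y} → Within G a x y → Within G a y x
  within-sym (_ , m≤a , p) = _ , m≤a , reverseʷ p

  within-mono : ∀ {a b x y} → a ≤ b → Within G a x y → Within G b x y
  within-mono a≤b (_ , m≤a , p) = _ , ≤-trans m≤a a≤b , p

  within⇒connected : ∀ {a x y} → Within G a x y → Connected G x y
  within⇒connected (_ , _ , p) = _ , p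

  connected-sym : ∀ {x y} → Connected G x y → Connected G y x
  connected-sym (_ , p) = _ , reverseʷ p

  connected-trans : ∀ {x y z} → Connected G x y → Connected G y z → Connected G x z
  connected-trans (_ , p) (_ , q) = _ , p ++ʷ q

  isDist : ∀ {d x y} → Within G d x y → (∀ n → Walk G n x y → d ≤ n) → IsDist G x y d
  isDist {_} {x} {y} (n , n≤d , p) d≤ =
    subst (λ k → Walk G k x y) (≤-antisym n≤d (d≤ n p)) p , d≤

  isDist-sym : ∀ {d x y} → IsDist G x y d → IsDist G y x d
  isDist-sym (p , d≤) = reverseʷ p , λ n q → d≤ n (reverseʷ q)

  walk-lipschitz : (f : Vertex G → ℕ) → (∀ {x y} → Adj G x y → f y ≤ suc (f x)) →
                   ∀ {n x y} → Walk G n x y → f y ≤ n + f x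
  walk-lipschitz f f-lip []                  = ≤-refl
  walk-lipschitz f f-lip {suc n} {x} (_∷_ {v = v} e p) =
    ≤-trans (walk-lipschitz f f-lip p)
      (≤-trans (+-monoʳ-≤ n (f-lip e)) (≤-reflexive (+-suc n (f x))))

-- Unlike IsDiam, these bound distances by exhibiting walks: distances need not
-- be computable in a general graph, whereas walks carry over to larger graphs.
HasDiam : (G : Graph) → (Vertex G → Set) → ℕ → Set
HasDiam G C d =
  (∃[ x ] ∃[ y ] (C x × C y × IsDist G x y d)) × (∀ x y → C x → C y → Within G d x y)

HasEcc : (G : Graph) → (Vertex G → Set) → Vertex G → ℕ → Set
HasEcc G C u e = (∃[ w ] (C w × IsDist G u w e)) × (∀ x → C x → Within G e u x)

hasDiam⇒isDiam : ∀ {G C d} → HasDiam G C d → IsDiam G C d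
hasDiam⇒isDiam (far , near) = far , λ x y cx cy n (_ , n≤) →
  let (k , k≤d , p) = near x y cx cy in ≤-trans (n≤ k p) k≤d

-- Joining two components by an edge

-- Takes one summand out at an arbitrary index, as is needed to trade the diameters of the two old
-- components for that of the joined one.
sum-punchIn : ∀ {n} (f : Fin (suc n) → ℕ) i →
              sum (tabulate f) ≡ f i + sum (tabulate (f ∘ punchIn i))
sum-punchIn f zero = refl
sum-punchIn {suc n} f (suc i) = begin
  f zero + sum (tabulate (f ∘ suc))
    ≡⟨ cong (f zero +_) (sum-punchIn (f ∘ suc) i) ⟩
  f zero + (f (suc i) + sum (tabulate (f ∘ suc ∘ punchIn i)))
    ≡⟨ swap (f zero) (f (suc i)) _ ⟩
  f (suc i) + (f zero + sum (tabulate (f ∘ suc ∘ punchIn i))) ∎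
  where
  open ≡-Reasoning
  swap : ∀ a b c → a + (b + c) ≡ b + (a + c)
  swap = solve-∀

sum-const : ∀ n c → sum (tabulate {n = n} (const c)) ≡ n * c
sum-const zero    c = refl
sum-const (suc n) c = cong (c +_) (sum-const n c)

module _ (G : Graph) (u v : Vertex G) (u≢v : u ≢ v) where

  private S = addEdge G u v u≢v

  -- Lengths are bounded by `n` rather than equal to it, because cutting out repeated crossings
  -- shortens the walk.
  data Split (x y : Vertex G) (n : ℕ) : Set where
    direct   : Within G n x y → Split x y n
    forward  : ∀ {a b} → Walk G a x u → Walk G b v y → a + suc b ≤ n → Split x y n
    backward : ∀ {a b} → Walk G a x v → Walk G b u y → a + suc b ≤ n → Split x y n

  private
    b≤ : ∀ {a b n} → a + suc b ≤ n → b ≤ n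
    b≤ {a} {b} = ≤-trans (≤-trans (n≤1+n b) (m≤n+m (suc b) a))

  -- A walk need not use the new edge twice.
  split : ∀ {n x y} → Walk S n x y → Split x y n
  split [] = direct (0 , z≤n , [])
  split (inj₁ e ∷ p) with split p
  ... | direct (k , k≤n , q) = direct (suc k , s≤s k≤n , e ∷ q)
  ... | forward q r a+b≤n    = forward (e ∷ q) r (s≤s a+b≤n)
  ... | backward q r a+b≤n   = backward (e ∷ q) r (s≤s a+b≤n)
  split (inj₂ (inj₁ (refl , refl)) ∷ p) with split p
  ... | direct (k , k≤n , q)       = forward [] q (s≤s k≤n)
  ... | forward {a} {b} q r a+b≤n  = forward [] r (s≤s (b≤ {a} a+b≤n))
  ... | backward {a} {b} q r a+b≤n = direct (b , m≤n⇒m≤1+n (b≤ {a} a+b≤n) , r)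
  split (inj₂ (inj₂ (refl , refl)) ∷ p) with split p
  ... | direct (k , k≤n , q)       = backward [] q (s≤s k≤n)
  ... | backward {a} {b} q r a+b≤n = backward [] r (s≤s (b≤ {a} a+b≤n))
  ... | forward {a} {b} q r a+b≤n  = direct (b , m≤n⇒m≤1+n (b≤ {a} a+b≤n) , r)

  liftʷ : ∀ {n x y} → Walk G n x y → Walk S n x y
  liftʷ []      = []
  liftʷ (e ∷ p) = inj₁ e ∷ liftʷ p

  within-lift : ∀ {n x y} → Within G n x y → Within S n x y
  within-lift (_ , k≤n , p) = _ , k≤n , liftʷ p

  newEdge : Adj S u v
  newEdge = inj₂ (inj₁ (refl , refl))

  module Attach {k : ℕ} (C : Components G (suc (suc k))) (diam : Fin (suc (suc k)) → ℕ)
                (hasDiam : ∀ i → HasDiam G (λ x → Components.comp C x ≡ i) (diam i))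
                (cu≢cv : Components.comp C u ≢ Components.comp C v) {a b : ℕ}
                (ecc-u : HasEcc G (λ x → Components.comp C x ≡ Components.comp C u) u a)
                (ecc-v : HasEcc G (λ x → Components.comp C x ≡ Components.comp C v) v b)
                (diam-u≤ : diam (Components.comp C u) ≤ a + suc b)
                (diam-v≤ : diam (Components.comp C v) ≤ a + suc b)
    where

    open Components C

    private
      cu cv : Fin (suc (suc k))
      cu = comp u
      cv = comp v

      conn : ∀ {x y} → comp x ≡ comp y → Connected G x y
      conn {x} {y} = Equivalence.to (connected x y)

      comp-walk : ∀ {n x y} → Walk G n x y → comp x ≡ comp y
      comp-walk {_} {x} {y} p = Equivalence.from (connected x y) (_ , p)

    -- The index `cv` is deleted and the others close the gap, which makes `punchIn cv` a section;
    -- `cv` itself goes where `cu` goes.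
    merge : Fin (suc (suc k)) → Fin (suc k)
    merge i with cv ≟ᶠ i
    ... | yes _    = punchOut (cu≢cv ∘ sym)
    ... | no cv≢i = punchOut cv≢i

    joined : Fin (suc k)
    joined = punchOut (cu≢cv ∘ sym)

    merge-cv : merge cv ≡ joined
    merge-cv with cv ≟ᶠ cv
    ... | yes _     = refl
    ... | no cv≢cv = ⊥-elim (cv≢cv refl)

    merge-punchIn : ∀ j → merge (punchIn cv j) ≡ j
    merge-punchIn j with cv ≟ᶠ punchIn cv j
    ... | yes eq = ⊥-elim (punchInᵢ≢i cv j (sym eq))
    ... | no _   = punchOut-punchIn cv

    merge-cu : merge cu ≡ joined
    merge-cu = trans (cong merge (sym (punchIn-punchOut (cu≢cv ∘ sym)))) (merge-punchIn joined)

    merge-inv : ∀ i j → merge i ≡ j → i ≡ punchIn cv j ⊎ (i ≡ cv × j ≡ joined)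
    merge-inv i j eq with cv ≟ᶠ i
    ... | yes cv≡i = inj₂ (sym cv≡i , sym eq)
    ... | no cv≢i  = inj₁ (trans (sym (punchIn-punchOut cv≢i)) (cong (punchIn cv) eq))

    merge-joined : ∀ i → merge i ≡ joined → i ≡ cu ⊎ i ≡ cv
    merge-joined i eq with merge-inv i joined eq
    ... | inj₁ i≡       = inj₁ (trans i≡ (punchIn-punchOut (cu≢cv ∘ sym)))
    ... | inj₂ (i≡ , _) = inj₂ i≡

    merge-other : ∀ i j → j ≢ joined → merge i ≡ j → i ≡ punchIn cv j
    merge-other i j j≢ eq with merge-inv i j eq
    ... | inj₁ i≡       = i≡
    ... | inj₂ (_ , j≡) = ⊥-elim (j≢ j≡)

    comp′ : Vertex S → Fin (suc k)
    comp′ = merge ∘ comp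

    connected-lift : ∀ {x y} → comp x ≡ comp y → Connected S x y
    connected-lift eq with conn eq
    ... | n , p = n , liftʷ p

    joined-connected : ∀ x → comp x ≡ cu ⊎ comp x ≡ cv → Connected S u x
    joined-connected x (inj₁ eq) = connected-lift (sym eq)
    joined-connected x (inj₂ eq) with connected-lift {v} {x} (sym eq)
    ... | n , p = suc n , newEdge ∷ p

    components : Components S (suc k)
    components = record
      { comp       = comp′
      ; surjective = λ j → let (x , eq) = surjective (punchIn cv j) in
                       x , λ { refl → trans (cong merge (eq refl)) (merge-punchIn j) }
      ; connected  = λ x y → mk⇔ (to x y) (from x y)
      }
      where
      to : ∀ x y → comp′ x ≡ comp′ y → Connected S x y
      to x y eq with comp′ y ≟ᶠ joined
      ... | yes y∈ = connected-trans
              (connected-sym (joined-connected x (merge-joined _ (trans eq y∈))))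
              (joined-connected y (merge-joined _ y∈))
      ... | no y∉  = connected-lift
              (trans (merge-other _ _ y∉ eq) (sym (merge-other _ _ y∉ refl)))
      from : ∀ x y → Connected S x y → comp′ x ≡ comp′ y
      from x y (n , p) with split p
      ... | direct (_ , _ , q) = cong merge (comp-walk q)
      -- Only the crossing changes the old index, and `merge` identifies its two sides.
      ... | forward q r _      = begin
              comp′ x ≡⟨ cong merge (comp-walk q) ⟩ merge cu ≡⟨ trans merge-cu (sym merge-cv) ⟩
              merge cv ≡⟨ cong merge (comp-walk r) ⟩ comp′ y ∎
              where open ≡-Reasoning
      ... | backward q r _     = begin
              comp′ x ≡⟨ cong merge (comp-walk q) ⟩ merge cv ≡⟨ trans merge-cv (sym merge-cu) ⟩
              merge cu ≡⟨ cong merge (comp-walk r) ⟩ comp′ y ∎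
              where open ≡-Reasoning

    -- A single crossing would leave the old component for good, so a split walk with both ends in
    -- one old component is `direct`.
    isDist-within : ∀ {x y d} → comp x ≡ comp y → IsDist G x y d → IsDist S x y d
    isDist-within {x} {y} {d} x~y (p , d≤) = liftʷ p , lower
      where
      lower : ∀ n → Walk S n x y → d ≤ n
      lower n w with split w
      ... | direct (m , m≤n , q) = ≤-trans (d≤ m q) m≤n
      ... | forward q r _  = ⊥-elim (cu≢cv (trans (sym (comp-walk q)) (trans x~y (sym (comp-walk r)))))
      ... | backward q r _ = ⊥-elim (cu≢cv (trans (comp-walk r) (trans (sym x~y) (comp-walk q))))

    -- The edge is a bridge: a split walk between its two sides must be `forward`, and its two
    -- halves are bounded separately.
    isDist-across : ∀ {x y c d} → IsDist G x u c → IsDist G v y d → IsDist S x y (c + suc d)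
    isDist-across {x} {y} {c} {d} (p , c≤) (q , d≤) = liftʷ p ++ʷ (newEdge ∷ liftʷ q) , lower
      where
      lower : ∀ n → Walk S n x y → c + suc d ≤ n
      lower n w with split w
      ... | direct (_ , _ , r) =
              ⊥-elim (cu≢cv (trans (sym (comp-walk p)) (trans (comp-walk r) (sym (comp-walk q)))))
      ... | forward r s ≤n = ≤-trans (+-mono-≤ (c≤ _ r) (s≤s (d≤ _ s))) ≤n
      ... | backward r _ _ = ⊥-elim (cu≢cv (trans (sym (comp-walk p)) (comp-walk r)))

    diam′ : Fin (suc k) → ℕ
    diam′ j with j ≟ᶠ joined
    ... | yes _ = a + suc b
    ... | no _  = diam (punchIn cv j)

    hasDiam-joined : HasDiam S (λ x → comp′ x ≡ joined) (a + suc b)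
    hasDiam-joined =
      (let (w , cw , dw) = proj₁ ecc-u
           (z , cz , dz) = proj₁ ecc-v
       in w , z , trans (cong merge cw) merge-cu , trans (cong merge cz) merge-cv ,
          isDist-across (isDist-sym dw) dz) ,
      λ x y cx cy → near x y (merge-joined _ cx) (merge-joined _ cy)
      where
      across : ∀ x y → comp x ≡ cu → comp y ≡ cv → Within S (a + suc b) x y
      across x y cx cy = within-trans (within-sym (within-lift (proj₂ ecc-u x cx)))
        (within-trans (edge newEdge) (within-lift (proj₂ ecc-v y cy)))
      near : ∀ x y → comp x ≡ cu ⊎ comp x ≡ cv → comp y ≡ cu ⊎ comp y ≡ cv →
             Within S (a + suc b) x y
      near x y (inj₁ cx) (inj₁ cy) = within-mono diam-u≤ (within-lift (proj₂ (hasDiam cu) x y cx cy))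
      near x y (inj₁ cx) (inj₂ cy) = across x y cx cy
      near x y (inj₂ cx) (inj₁ cy) = within-sym (across y x cy cx)
      near x y (inj₂ cx) (inj₂ cy) = within-mono diam-v≤ (within-lift (proj₂ (hasDiam cv) x y cx cy))

    hasDiam′ : ∀ j → HasDiam S (λ x → comp′ x ≡ j) (diam′ j)
    hasDiam′ j with j ≟ᶠ joined
    ... | yes refl = hasDiam-joined
    ... | no j≢    =
      (let (x , y , cx , cy , d) = proj₁ (hasDiam (punchIn cv j)) in
       x , y , trans (cong merge cx) (merge-punchIn j) , trans (cong merge cy) (merge-punchIn j) ,
       isDist-within (trans cx (sym cy)) d) ,
      λ x y cx cy → within-lift
        (proj₂ (hasDiam (punchIn cv j)) x y (merge-other _ _ j≢ cx) (merge-other _ _ j≢ cy))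

    diam′-joined : diam′ joined ≡ a + suc b
    diam′-joined with joined ≟ᶠ joined
    ... | yes _ = refl
    ... | no ≢  = ⊥-elim (≢ refl)

    diam′-other : ∀ i → diam′ (punchIn joined i) ≡ diam (punchIn cv (punchIn joined i))
    diam′-other i with punchIn joined i ≟ᶠ joined
    ... | yes eq = ⊥-elim (punchInᵢ≢i joined i eq)
    ... | no _   = refl

    -- The two lost diameters are added on the left instead of subtracted on the right, since
    -- subtraction of naturals truncates.
    sum-diam′ : sum (tabulate diam′) + (diam cu + diam cv) ≡ sum (tabulate diam) + (a + suc b)
    sum-diam′ = begin
      sum (tabulate diam′) + (diam cu + diam cv)
        ≡⟨ cong (_+ (diam cu + diam cv)) (sum-punchIn diam′ joined) ⟩
      diam′ joined + sum (tabulate (diam′ ∘ punchIn joined)) + (diam cu + diam cv)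
        ≡⟨ cong₂ (λ s t → s + t + (diam cu + diam cv)) diam′-joined
             (cong sum (tabulate-cong diam′-other)) ⟩
      a + suc b + rest + (diam cu + diam cv)
        ≡⟨ swap (a + suc b) rest (diam cu) (diam cv) ⟩
      diam cv + (diam cu + rest) + (a + suc b)
        ≡⟨ cong (λ i → diam cv + (diam i + rest) + (a + suc b)) (sym (punchIn-punchOut (cu≢cv ∘ sym))) ⟩
      diam cv + (diam (punchIn cv joined) + rest) + (a + suc b)
        ≡⟨ cong (λ s → diam cv + s + (a + suc b)) (sym (sum-punchIn (diam ∘ punchIn cv) joined)) ⟩
      diam cv + sum (tabulate (diam ∘ punchIn cv)) + (a + suc b)
        ≡⟨ cong (_+ (a + suc b)) (sym (sum-punchIn diam cv)) ⟩
      sum (tabulate diam) + (a + suc b) ∎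
      where
      open ≡-Reasoning
      rest = sum (tabulate (diam ∘ punchIn cv ∘ punchIn joined))
      swap : ∀ d r x y → d + r + (x + y) ≡ y + (x + r) + d
      swap = solve-∀

    isMeanDiam : ∃[ t ] (IsMeanDiam S ((ℤ.+ t) ℚ./ suc k) ×
                         t + (diam cu + diam cv) ≡ sum (tabulate diam) + (a + suc b))
    isMeanDiam = sum (tabulate diam′) ,
      (suc k , _ , components , diam′ , (λ j → hasDiam⇒isDiam (hasDiam′ j)) , refl) , sum-diam′

-- Distances in graphs whose vertices are labelled by naturals

-- Two-sided, because `fromEdges` takes the symmetric closure and a walk may traverse an edge in
-- either direction.
Close : ℕ → ℕ → Set
Close a b = a ≤ suc b × b ≤ suc a

close-refl : ∀ {a} → Close a a
close-refl = n≤1+n _ , n≤1+n _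

close-step : ∀ {a} → Close a (suc a)
close-step = m≤n⇒m≤1+n (n≤1+n _) , ≤-refl

close-sym : ∀ {a b} → Close a b → Close b a
close-sym (p , q) = q , p

close-suc : ∀ {a b} → Close a b → Close (suc a) (suc b)
close-suc (p , q) = s≤s p , s≤s q

close-⊓ : ∀ {a b c d} → Close a b → Close c d → Close (a ⊓ c) (b ⊓ d)
close-⊓ (p , q) (r , s) = ⊓-mono-≤ p r , ⊓-mono-≤ q s

close-∸ : ∀ l {a b} → Close a b → Close (l ∸ a) (l ∸ b)
close-∸ l {a} {b} (p , q) = bound q , bound p
  where
  bound : ∀ {a b} → b ≤ suc a → l ∸ a ≤ suc (l ∸ b)
  bound {a} {b} b≤ = m≤n+o⇒m∸n≤o l a (≤-trans (m≤n+m∸n l b) (≤-trans (+-monoˡ-≤ (l ∸ b) b≤)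
    (≤-reflexive (sym (+-suc a (l ∸ b))))))

close-∣-∣ : ∀ i j → Close ∣ i - j ∣ ∣ i - suc j ∣
close-∣-∣ zero    j       = close-step
close-∣-∣ (suc i) zero    rewrite ∣-∣-identityʳ i = close-sym close-step
close-∣-∣ (suc i) (suc j) = close-∣-∣ i j

-- Odd labels are rim vertices and even labels are pendant ones, so a potential is given by one
-- formula for each. Shifting both functions in the recursion avoids halving the label.
alternate : (ℕ → ℕ) → (ℕ → ℕ) → ℕ → ℕ
alternate e o zero          = e 0
alternate e o (suc zero)    = o 0
alternate e o (suc (suc a)) = alternate (e ∘ suc) (o ∘ suc) a

alternate-even : ∀ e o k → alternate e o (2 * k) ≡ e k
alternate-even e o zero    = refl
alternate-even e o (suc k) rewrite +-suc k (k + 0) = alternate-even (e ∘ suc) (o ∘ suc) k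

alternate-odd : ∀ e o k → alternate e o (2 * k + 1) ≡ o k
alternate-odd e o zero    = refl
alternate-odd e o (suc k) rewrite +-suc k (k + 0) = alternate-odd (e ∘ suc) (o ∘ suc) k

2*[1+k]∸1 : ∀ k → 2 * suc k ∸ 1 ≡ 2 * k + 1
2*[1+k]∸1 k = trans (cong pred (*-suc 2 k)) (+-comm 1 (2 * k))

even-or-odd : ∀ a → ∃[ k ] (a ≡ 2 * k ⊎ a ≡ 2 * k + 1)
even-or-odd zero = 0 , inj₁ refl
even-or-odd (suc a) with even-or-odd a
... | k , inj₁ refl = k , inj₂ (+-comm 1 (2 * k))
... | k , inj₂ refl = suc k , inj₁ (trans (cong suc (+-comm (2 * k) 1)) (sym (*-suc 2 k)))

module _ {n : ℕ} (E : Rel ℕ 0ℓ) where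

  label-lipschitz : (f : ℕ → ℕ) → (∀ {a b} → E a b → Close (f a) (f b)) →
                    ∀ {k x y} → Walk (fromEdges n E) k x y → f (toℕ y) ≤ k + f (toℕ x)
  label-lipschitz f f-close = walk-lipschitz (f ∘ toℕ)
    λ { (_ , fwd e) → proj₂ (f-close e) ; (_ , bwd e) → proj₁ (f-close e) }

  label-adj : ∀ {a b} → E a b → a ≢ b → .(p : a < n) .(q : b < n) →
              Adj (fromEdges n E) (fromℕ< p) (fromℕ< q)
  label-adj {a} {b} e a≢b p q =
    (λ eq → a≢b (trans (sym (toℕ-fromℕ< p)) (trans (cong toℕ eq) (toℕ-fromℕ< q)))) ,
    fwd (subst₂ E (sym (toℕ-fromℕ< p)) (sym (toℕ-fromℕ< q)) e)

label-view : ∀ {n} (x : Fin n) {a} → toℕ x ≡ a → (a<n : a < n) → x ≡ fromℕ< a<n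
label-view x refl a<n = sym (fromℕ<-toℕ x a<n)

-- Shared by both kinds of component: `r` lists the rim vertices of the cycle or of the path.
module _ {G : Graph} {n : ℕ} (r : ∀ i → .(i < n) → Vertex G)
         (step : ∀ i (p : i < n) (q : suc i < n) → Adj G (r i p) (r (suc i) q)) where

  path-up : ∀ d {i j} → d + i ≡ j → (p : i < n) (q : j < n) → Walk G d (r i p) (r j q)
  path-up zero    refl p q = []
  path-up (suc d) {i} refl p q = step i p i+1<n ∷ path-up d (+-suc d i) i+1<n q
    where
    i+1<n : suc i < n
    i+1<n = ≤-trans (s≤s (s≤s (m≤n+m i d))) q

  path : ∀ i j (p : i < n) (q : j < n) → Within G ∣ i - j ∣ (r i p) (r j q)
  path i j p q with ≤-total i j
  ... | inj₁ i≤j = j ∸ i , ≤-reflexive (sym (m≤n⇒∣m-n∣≡n∸m i≤j)) ,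
                   path-up (j ∸ i) (m∸n+n≡m i≤j) p q
  ... | inj₂ j≤i = i ∸ j , ≤-reflexive (sym (m≤n⇒∣n-m∣≡n∸m j≤i)) ,
                   reverseʷ (path-up (i ∸ j) (m∸n+n≡m j≤i) q p)

Everywhere : ∀ {a} {A : Set a} → A → Set
Everywhere _ = ⊤

-- If each vertex of a graph is given a pendant neighbour, the neighbours of two
-- vertices at distance t are at distance pendant t.
pendant : ℕ → ℕ
pendant zero    = 0
pendant (suc t) = suc (suc (suc t))

pendant≡+2 : ∀ {t} → 1 ≤ t → pendant t ≡ t + 2
pendant≡+2 {suc t} _ = cong suc (+-comm 2 t)

-- `suc t` is the distance from a pendant vertex to a rim vertex at rim distance `t`, so this is the
-- Lipschitz condition along the edge from that rim vertex to its own pendant neighbour.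
close-pendant : ∀ t → Close (pendant t) (suc t)
close-pendant zero    = z≤n , s≤s z≤n
close-pendant (suc t) = close-sym close-step

-- The stacked component: a cycle of odd vertices, each with a pendant even one

-- Brings the edge labels into the forms `2 * i` and `2 * i + 1`, to which `alternate-even` and
-- `alternate-odd` apply.
stackedEdge-elim : ∀ {L} (P : Rel ℕ 0ℓ) → (∀ i → P (2 * i) (2 * i + 1)) →
                   (∀ i → P (2 * i + 1) (2 * suc i + 1)) → P (2 * (L ∸ 1) + 1) 1 →
                   ∀ {a b} → 1 ≤ L → StackedEdge L a b → P a b
stackedEdge-elim P v s c 1≤L (vertical i _) = v i
stackedEdge-elim P v s c 1≤L (surface i _)  =
  subst (P (2 * i + 1)) (sym (label i)) (s i)
  where
  label : ∀ i → 2 * i + 3 ≡ 2 * suc i + 1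
  label = solve-∀
stackedEdge-elim {suc l} P v s c 1≤L closing =
  subst (λ a → P a 1) (sym (2*[1+k]∸1 l)) c

-- Here `L = 2m + 1`, so this `m` is one more than that of the overview; it is the largest distance
-- on the rim. By `1≤m` the closing edge is not a loop.
module Stacked (m : ℕ) (1≤m : 1 ≤ m) where

  private
    L : ℕ
    L = suc (2 * m)

    T : Graph
    T = 𝓣 L

    leaf< : ∀ {i} → i < L → 2 * i < 2 * L
    leaf< = *-monoʳ-< 2

    rim< : ∀ {i} → i < L → 2 * i + 1 < 2 * L
    rim< {i} i<L = ≤-trans (≤-reflexive (label i)) (*-monoʳ-≤ 2 i<L)
      where
      label : ∀ i → suc (2 * i + 1) ≡ 2 * suc i
      label = solve-∀

  leaf rim : ∀ i → .(i < L) → Vertex T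
  leaf i i<L = fromℕ< (leaf< i<L)
  rim  i i<L = fromℕ< (rim< i<L)

  leaf-rim : ∀ i (i<L : i < L) → Adj T (leaf i i<L) (rim i i<L)
  leaf-rim i i<L = label-adj (StackedEdge L) (vertical i (≤-pred i<L)) (<⇒≢ (m<m+n _ (s≤s z≤n)))
    (leaf< i<L) (rim< i<L)

  rim-step : ∀ i (p : i < L) (q : suc i < L) → Adj T (rim i p) (rim (suc i) q)
  rim-step i p q = label-adj (StackedEdge L) (subst (StackedEdge L (2 * i + 1)) (label i)
      (surface i (∸-monoˡ-≤ 2 q)))
    (<⇒≢ (+-monoˡ-< 1 (*-monoʳ-< 2 (n<1+n i)))) (rim< p) (rim< q)
    where
    label : ∀ i → 2 * i + 3 ≡ 2 * suc i + 1
    label = solve-∀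

  rim-closing : Adj T (rim (2 * m) ≤-refl) (rim 0 (s≤s z≤n))
  rim-closing = label-adj (StackedEdge L) (subst (λ a → StackedEdge L a 1) (2*[1+k]∸1 (2 * m)) closing)
    (≢-sym (<⇒≢ (+-monoˡ-< 1 (*-monoʳ-< 2 {0} {2 * m} (≤-trans 1≤m (m≤m+n m (m + 0)))))))
    (rim< {2 * m} ≤-refl) (rim< {0} (s≤s z≤n))

  to-rim : ∀ x → ∃[ i ] ∃[ i<L ] Within T 1 x (rim i i<L)
  to-rim x with even-or-odd (toℕ x)
  ... | i , inj₁ eq = i , i<L , subst (λ y → Within T 1 y (rim i i<L))
                        (sym (label-view x eq (leaf< i<L))) (edge (leaf-rim i i<L))
    where
    i<L : i < L
    i<L = *-cancelˡ-< 2 i L (subst (_< 2 * L) eq (toℕ<n x))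
  ... | i , inj₂ eq = i , i<L , subst (λ y → Within T 1 y (rim i i<L))
                        (sym (label-view x eq (rim< i<L))) (0 , z≤n , [])
    where
    i<L : i < L
    i<L = *-cancelˡ-< 2 i L (≤-trans (s≤s (m≤m+n (2 * i) 1)) (subst (_< 2 * L) eq (toℕ<n x)))

  -- The two arcs between `i` and `j` have total length `2m + 1`, so one of them has length at most
  -- `m`.
  rim-near-≤ : ∀ {i j} (p : i < L) (q : j < L) → i ≤ j → Within T m (rim i p) (rim j q)
  rim-near-≤ {i} {j} p q i≤j with j ∸ i ≤? m
  ... | yes d≤m = within-mono (≤-trans (≤-reflexive (m≤n⇒∣m-n∣≡n∸m i≤j)) d≤m)
                    (path rim rim-step i j p q)
  ... | no d≰m  = within-mono around
                    (within-trans (path rim rim-step i 0 p (s≤s z≤n))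
                      (within-trans (within-sym (edge rim-closing))
                        (path rim rim-step (2 * m) j ≤-refl q)))
    where
    -- The arc down to 0, over the closing edge and back down from `2 * m`. Adding `m + j` to both
    -- sides removes the subtractions.
    around : ∣ i - 0 ∣ + (1 + ∣ 2 * m - j ∣) ≤ m
    around = +-cancelʳ-≤ (m + j) _ _ (begin
      ∣ i - 0 ∣ + suc ∣ 2 * m - j ∣ + (m + j)
        ≡⟨ cong₂ (λ s t → s + suc t + (m + j)) (∣-∣-identityʳ i) (m≤n⇒∣n-m∣≡n∸m j≤2m) ⟩
      i + suc (2 * m ∸ j) + (m + j)   ≡⟨ shuffle₁ i (2 * m ∸ j) m j ⟩
      2 * m ∸ j + j + suc (i + m)     ≡⟨ cong (_+ suc (i + m)) (m∸n+n≡m j≤2m) ⟩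
      2 * m + suc (i + m)             ≡⟨ shuffle₂ i m ⟩
      m + (m + (i + suc m))           ≤⟨ +-monoʳ-≤ m (+-monoʳ-≤ m (+-monoʳ-≤ i (≰⇒> d≰m))) ⟩
      m + (m + (i + (j ∸ i)))         ≡⟨ cong (λ k → m + (m + k)) (m+[n∸m]≡n i≤j) ⟩
      m + (m + j)                     ∎)
      where
      open ≤-Reasoning
      j≤2m : j ≤ 2 * m
      j≤2m = ≤-pred q
      shuffle₁ : ∀ i s m j → i + suc s + (m + j) ≡ s + j + suc (i + m)
      shuffle₁ = solve-∀
      shuffle₂ : ∀ i m → 2 * m + suc (i + m) ≡ m + (m + (i + suc m))
      shuffle₂ = solve-∀

  rim-near : ∀ {i j} (p : i < L) (q : j < L) → Within T m (rim i p) (rim j q)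
  rim-near {i} {j} p q with ≤-total i j
  ... | inj₁ i≤j = rim-near-≤ p q i≤j
  ... | inj₂ j≤i = within-sym (rim-near-≤ q p j≤i)

  near : ∀ x y → Within T (m + 2) x y
  near x y =
    let (i , p , wx) = to-rim x
        (j , q , wy) = to-rim y
    in within-mono (≤-reflexive (shuffle m))
         (within-trans wx (within-trans (rim-near p q) (within-sym wy)))
    where
    shuffle : ∀ m → 1 + (m + 1) ≡ m + 2
    shuffle = solve-∀

  -- The length of the shorter arc between rim vertices whose indices differ by `a`.
  cyclic : ℕ → ℕ
  cyclic a = a ⊓ (L ∸ a)

  -- The distance from `leaf i`, to the leaves in the first formula and to the rim in the second.
  potential : ℕ → ℕ → ℕ
  potential i = alternate (λ j → pendant (cyclic ∣ i - j ∣)) (λ j → suc (cyclic ∣ i - j ∣))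

  potential-close : ∀ i → i < L → ∀ {a b} → StackedEdge L a b →
                    Close (potential i a) (potential i b)
  potential-close i i<L = stackedEdge-elim (λ a b → Close (potential i a) (potential i b))
    (λ j → subst₂ Close (sym (alternate-even _ _ j)) (sym (alternate-odd _ _ j)) (close-pendant _))
    (λ j → subst₂ Close (sym (alternate-odd _ _ j)) (sym (alternate-odd _ _ (suc j)))
             (close-suc (close-⊓ (close-∣-∣ i j) (close-∸ L (close-∣-∣ i j)))))
    (subst (λ a → Close a (suc (cyclic ∣ i - 0 ∣))) (sym (alternate-odd _ _ (2 * m)))
      (close-suc ends))
    (s≤s z≤n)
    where
    i≤2m : i ≤ 2 * m
    i≤2m = ≤-pred i<L
    -- Going round the end of the cycle exchanges the two arcs.
    ends : Close (cyclic ∣ i - 2 * m ∣) (cyclic ∣ i - 0 ∣)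
    ends = subst₂ Close (sym far) (sym home) (close-⊓ close-step (close-sym close-step))
      where
      open ≡-Reasoning
      far : cyclic ∣ i - 2 * m ∣ ≡ (2 * m ∸ i) ⊓ suc i
      far = begin
        cyclic ∣ i - 2 * m ∣                  ≡⟨ cong cyclic (m≤n⇒∣m-n∣≡n∸m i≤2m) ⟩
        (2 * m ∸ i) ⊓ (L ∸ (2 * m ∸ i))       ≡⟨ cong ((2 * m ∸ i) ⊓_) (+-∸-assoc 1 (m∸n≤m (2 * m) i)) ⟩
        (2 * m ∸ i) ⊓ suc (2 * m ∸ (2 * m ∸ i)) ≡⟨ cong (λ a → (2 * m ∸ i) ⊓ suc a) (m∸[m∸n]≡n i≤2m) ⟩
        (2 * m ∸ i) ⊓ suc i                   ∎
      home : cyclic ∣ i - 0 ∣ ≡ suc (2 * m ∸ i) ⊓ i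
      home = begin
        cyclic ∣ i - 0 ∣     ≡⟨ cong cyclic (∣-∣-identityʳ i) ⟩
        i ⊓ (L ∸ i)          ≡⟨ ⊓-comm i (L ∸ i) ⟩
        (L ∸ i) ⊓ i          ≡⟨ cong (_⊓ i) (+-∸-assoc 1 i≤2m) ⟩
        suc (2 * m ∸ i) ⊓ i  ∎

  -- The witness is `i + m` modulo `L`; beyond the middle it wraps round to `i ∸ suc m`.
  opposite : ∀ i → i < L → ∃[ j ] (j < L × cyclic ∣ i - j ∣ ≡ m)
  opposite i i<L with i ≤? m
  ... | yes i≤m = i + m , s≤s (≤-trans (+-monoˡ-≤ m i≤m) (≤-reflexive (cong (m +_) (sym (+-identityʳ m))))) ,
        trans (cong cyclic (trans (m≤n⇒∣m-n∣≡n∸m (m≤m+n i m)) (m+n∸m≡n i m))) cyclic-m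
    where
    cyclic-m : cyclic m ≡ m
    cyclic-m = m≤n⇒m⊓n≡m (m+n≤o⇒m≤o∸n m
      (≤-trans (≤-reflexive (cong (m +_) (sym (+-identityʳ m)))) (n≤1+n (2 * m))))
  ... | no i≰m = i ∸ suc m , ≤-trans (s≤s (m∸n≤m i (suc m))) i<L ,
        trans (cong cyclic (trans (m≤n⇒∣n-m∣≡n∸m (m∸n≤m i (suc m))) (m∸[m∸n]≡n (≰⇒> i≰m)))) cyclic-suc-m
    where
    cyclic-suc-m : cyclic (suc m) ≡ m
    cyclic-suc-m = trans (cong (suc m ⊓_) (trans (m+n∸m≡n m (m + 0)) (+-identityʳ m)))
      (m≥n⇒m⊓n≡n (n≤1+n m))

  -- The pendant vertex at the opposite rim vertex is farthest. Every leaf has such a vertex, so all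
  -- leaves attain the diameter.
  leaf-hasEcc : ∀ u → 2 ∣ toℕ u → HasEcc T Everywhere u (m + 2)
  leaf-hasEcc u (divides i eq) =
    (leaf j j<L , tt , isDist (near _ _) λ n w → begin
      m + 2                                  ≡⟨ sym (pendant≡+2 1≤m) ⟩
      pendant m                              ≡⟨ cong pendant (sym j-opposite) ⟩
      pendant (cyclic ∣ i - j ∣)             ≡⟨ sym (alternate-even _ _ j) ⟩
      potential i (2 * j)                    ≡⟨ cong (potential i) (sym (toℕ-fromℕ< (leaf< j<L))) ⟩
      potential i (toℕ (leaf j j<L))         ≤⟨ label-lipschitz (StackedEdge L) (potential i) (potential-close i i<L) w ⟩
      n + potential i (toℕ u)                ≡⟨ cong (λ a → n + potential i a) u≡ ⟩
      n + potential i (2 * i)                ≡⟨ cong (n +_) (alternate-even _ _ i) ⟩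
      n + pendant (cyclic ∣ i - i ∣)         ≡⟨ cong (λ a → n + pendant (cyclic a)) (∣n-n∣≡0 i) ⟩
      n + 0                                  ≡⟨ +-identityʳ n ⟩
      n                                      ∎) ,
    λ x _ → near u x
    where
    open ≤-Reasoning
    u≡ : toℕ u ≡ 2 * i
    u≡ = trans eq (*-comm i 2)
    i<L : i < L
    i<L = *-cancelˡ-< 2 i L (subst (_< 2 * L) u≡ (toℕ<n u))
    j = proj₁ (opposite i i<L)
    j<L = proj₁ (proj₂ (opposite i i<L))
    j-opposite = proj₂ (proj₂ (opposite i i<L))

  hasDiam : HasDiam T Everywhere (m + 2)
  hasDiam =
    (let (w , _ , d) = proj₁ (leaf-hasEcc zero (divides 0 refl)) in zero , w , tt , tt , d) ,
    λ x y _ _ → near x y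

-- The folded component: a path of odd vertices with pendant even ones

foldedEdge-elim : ∀ {L} (P : Rel ℕ 0ℓ) → (∀ k → P (2 * k + 1) (2 * suc k + 1)) →
                  (∀ k → P (2 * k + 1) (2 * suc k)) → P 0 1 →
                  ∀ {a b} → FoldedEdge L a b → P a b
foldedEdge-elim P s v f (surface (suc k) _ _) =
  subst (λ a → P a (2 * suc k + 1)) (sym (2*[1+k]∸1 k)) (s k)
foldedEdge-elim P s v f (vertical k _) = subst (P (2 * k + 1)) (label k) (v k)
  where
  label : ∀ k → 2 * suc k ≡ 2 * k + 2
  label = solve-∀
foldedEdge-elim P s v f fold = f

-- The path is `rim 0` to `rim m`. `leaf (suc i)` hangs from `rim i`, and `leaf 0`, which is not a
-- floor vertex, also hangs from `rim 0`; hence the shift by one between leaves and rim.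
module Folded (m : ℕ) where

  private
    L : ℕ
    L = suc (2 * suc m)

    F : Graph
    F = 𝓕 L

    edge-bound : ∀ {k} → k ≤ m → k ≤ (L ∸ 3) / 2
    edge-bound {k} k≤m = subst (k ≤_) (sym half) k≤m
      where
      half : (L ∸ 3) / 2 ≡ m
      half = trans (/-congˡ (trans (cong (_∸ 2) (*-suc 2 m)) (*-comm 2 m))) (m*n/n≡m m 2)

    leaf< : ∀ {i} → i ≤ suc m → 2 * i < L
    leaf< i≤m+1 = s≤s (*-monoʳ-≤ 2 i≤m+1)

    rim< : ∀ {i} → i < suc m → 2 * i + 1 < L
    rim< {i} i<m+1 = s≤s (≤-trans (≤-reflexive (+-comm (2 * i) 1)) (*-monoʳ-< 2 i<m+1))

  leaf : ∀ i → .(i ≤ suc m) → Vertex F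
  leaf i i≤m+1 = fromℕ< (leaf< i≤m+1)

  rim : ∀ i → .(i < suc m) → Vertex F
  rim i i<m+1 = fromℕ< (rim< i<m+1)

  rim-leaf : ∀ i (i<m+1 : i < suc m) → Adj F (rim i i<m+1) (leaf (suc i) i<m+1)
  rim-leaf i i<m+1 = label-adj (FoldedEdge L)
    (subst (FoldedEdge L (2 * i + 1)) (label i) (vertical i (edge-bound (≤-pred i<m+1))))
    (<⇒≢ (≤-reflexive (label′ i)))
    (rim< i<m+1) (leaf< i<m+1)
    where
    label : ∀ i → 2 * i + 2 ≡ 2 * suc i
    label = solve-∀
    label′ : ∀ i → suc (2 * i + 1) ≡ 2 * suc i
    label′ = solve-∀

  rim-step : ∀ i (p : i < suc m) (q : suc i < suc m) → Adj F (rim i p) (rim (suc i) q)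
  rim-step i p q = label-adj (FoldedEdge L)
    (subst (λ a → FoldedEdge L a (2 * suc i + 1)) (2*[1+k]∸1 i)
      (surface (suc i) (s≤s z≤n) (edge-bound (≤-pred q))))
    (<⇒≢ (+-monoˡ-< 1 (*-monoʳ-< 2 (n<1+n i))))
    (rim< p) (rim< q)

  fold-adj : Adj F (leaf 0 z≤n) (rim 0 (s≤s z≤n))
  fold-adj = label-adj (FoldedEdge L) fold (λ ()) (leaf< z≤n) (rim< {0} (s≤s z≤n))

  to-rim : ∀ x → ∃[ i ] ∃[ i<m+1 ] Within F 1 x (rim i i<m+1)
  to-rim x with even-or-odd (toℕ x)
  ... | zero  , inj₁ eq = 0 , s≤s z≤n , subst (λ y → Within F 1 y (rim 0 (s≤s z≤n)))
                            (sym (label-view x eq (leaf< z≤n))) (edge fold-adj)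
  ... | suc i , inj₁ eq = i , i<m+1 , subst (λ y → Within F 1 y (rim i i<m+1))
                            (sym (label-view x eq (leaf< i<m+1))) (within-sym (edge (rim-leaf i i<m+1)))
    where
    i<m+1 : suc i ≤ suc m
    i<m+1 = *-cancelˡ-≤ 2 (≤-pred (subst (_< L) eq (toℕ<n x)))
  ... | i , inj₂ eq     = i , i<m+1 , subst (λ y → Within F 1 y (rim i i<m+1))
                            (sym (label-view x eq (rim< i<m+1))) (0 , z≤n , [])
    where
    i<m+1 : suc i ≤ suc m
    i<m+1 = *-cancelˡ-< 2 i (suc m)
      (subst (_≤ 2 * suc m) (+-comm (2 * i) 1) (≤-pred (subst (_< L) eq (toℕ<n x))))

  near : ∀ x y → Within F (m + 2) x y
  near x y =
    let (i , p , wx) = to-rim x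
        (j , q , wy) = to-rim y
        i-j≤m = ≤-trans (∣m-n∣≤m⊔n i j) (⊔-lub (≤-pred p) (≤-pred q))
    in within-mono (≤-trans (s≤s (+-monoˡ-≤ 1 i-j≤m)) (≤-reflexive (sym (+-suc m 1))))
         (within-trans wx (within-trans (path rim rim-step i j p q) (within-sym wy)))

  -- The distances from the vertices 0 and L ∸ 1 at the two ends.
  depth height : ℕ → ℕ
  depth  = alternate (λ { zero → 0 ; (suc j) → suc (suc j) }) suc
  height = alternate (λ { zero → suc (suc m) ; (suc j) → pendant (m ∸ j) }) (suc m ∸_)

  depth-close : ∀ {a b} → FoldedEdge L a b → Close (depth a) (depth b)
  depth-close = foldedEdge-elim (λ a b → Close (depth a) (depth b))
    (λ k → subst₂ Close (sym (alternate-odd _ _ k)) (sym (alternate-odd _ _ (suc k))) close-step)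
    (λ k → subst₂ Close (sym (alternate-odd _ _ k)) (sym (alternate-even _ _ (suc k))) close-step)
    close-step

  height-close : ∀ {a b} → FoldedEdge L a b → Close (height a) (height b)
  height-close = foldedEdge-elim (λ a b → Close (height a) (height b))
    (λ k → subst₂ Close (sym (alternate-odd _ _ k)) (sym (alternate-odd _ _ (suc k)))
             (close-∸ (suc m) {k} close-step))
    (λ k → subst₂ Close (sym (alternate-odd _ _ k)) (sym (alternate-even _ _ (suc k)))
             -- Writing `m ∸ k` as a predecessor also covers `k > m`, where truncation makes both
             -- sides 0.
             (subst (λ t → Close (suc m ∸ k) (pendant t)) (pred[m∸n]≡m∸[1+n] (suc m) k)
               (close-pendant-pred (suc m ∸ k))))
    (close-sym close-step)
    where
    close-pendant-pred : ∀ a → Close a (pendant (pred a))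
    close-pendant-pred zero    = close-refl
    close-pendant-pred (suc a) = close-sym (close-pendant a)

  hasDiam : HasDiam F Everywhere (m + 2)
  hasDiam =
    (leaf 0 z≤n , leaf (suc m) ≤-refl , tt , tt , isDist (near _ _) λ n w → begin
      m + 2                               ≡⟨ +-comm m 2 ⟩
      suc (suc m)                         ≡⟨ sym (alternate-even _ _ (suc m)) ⟩
      depth (2 * suc m)                   ≡⟨ cong depth (sym (toℕ-fromℕ< (leaf< {suc m} ≤-refl))) ⟩
      depth (toℕ (leaf (suc m) ≤-refl))   ≤⟨ label-lipschitz (FoldedEdge L) depth (λ e → depth-close e) w ⟩
      n + 0                               ≡⟨ +-identityʳ n ⟩
      n                                   ∎) ,
    λ x y _ _ → near x y
    where open ≤-Reasoning

  -- The two inequalities say that `rim k` is within `c` of both ends of the path, hence of every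
  -- rim vertex.
  near-leaf : ∀ {k c} (k<m+1 : k < suc m) → k ≤ c → m ≤ k + c →
              ∀ x → Within F (c + 2) (leaf (suc k) k<m+1) x
  near-leaf {k} {c} k<m+1 k≤c m≤k+c x =
    let (j , q , w) = to-rim x
    in within-mono (≤-trans (s≤s (+-monoˡ-≤ 1 (bound (≤-pred q)))) (≤-reflexive (sym (+-suc c 1))))
         (within-trans (within-sym (edge (rim-leaf k k<m+1)))
           (within-trans (path rim rim-step k j k<m+1 q) (within-sym w)))
    where
    bound : ∀ {j} → j ≤ m → ∣ k - j ∣ ≤ c
    bound {j} j≤m with ≤-total k j
    ... | inj₁ k≤j = subst (_≤ c) (sym (m≤n⇒∣m-n∣≡n∸m k≤j)) (m≤n+o⇒m∸n≤o j k (≤-trans j≤m m≤k+c))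
    ... | inj₂ j≤k = subst (_≤ c) (sym (m≤n⇒∣n-m∣≡n∸m j≤k)) (≤-trans (m∸n≤m k j) k≤c)

  -- A farthest vertex hangs at the farther end of the path, so `c` is the larger of `k` and
  -- `m ∸ k`. These add up to `m`, which puts `c` between `m / 2` and `m`.
  leaf-hasEcc : ∀ k (k<m+1 : k < suc m) →
                ∃[ c ] (HasEcc F Everywhere (leaf (suc k) k<m+1) (c + 2) × c ≤ m × m ≤ 2 * c)
  leaf-hasEcc k k<m+1 with m ≤? k + k
  ... | yes m≤2k = k ,
    ((leaf 0 z≤n , tt , isDist (near-leaf k<m+1 ≤-refl m≤2k _) λ n w → begin
        k + 2                          ≡⟨ +-comm k 2 ⟩
        suc (suc k)                    ≡⟨ sym (alternate-even _ _ (suc k)) ⟩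
        depth (2 * suc k)              ≡⟨ cong depth (sym (toℕ-fromℕ< (leaf< k<m+1))) ⟩
        depth (toℕ (leaf (suc k) k<m+1)) ≤⟨ label-lipschitz (FoldedEdge L) depth (λ e → depth-close e) (reverseʷ w) ⟩
        n + 0                          ≡⟨ +-identityʳ n ⟩
        n                              ∎) ,
     λ x _ → near-leaf k<m+1 ≤-refl m≤2k x) ,
    ≤-pred k<m+1 , ≤-trans m≤2k (≤-reflexive (cong (k +_) (sym (+-identityʳ k))))
    where open ≤-Reasoning
  ... | no m≰2k = m ∸ k ,
    ((leaf (suc m) ≤-refl , tt , isDist (near-leaf k<m+1 k≤c m≤k+c _) λ n w → begin
        -- The tie `2k = m` went to `leaf 0`, so here `k < m` and the two leaves hang from different
        -- rim vertices.
        m ∸ k + 2                      ≡⟨ sym (pendant≡+2 (m<n⇒0<n∸m k<m)) ⟩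
        pendant (m ∸ k)                ≡⟨ sym (alternate-even _ _ (suc k)) ⟩
        height (2 * suc k)             ≡⟨ cong height (sym (toℕ-fromℕ< (leaf< k<m+1))) ⟩
        height (toℕ (leaf (suc k) k<m+1)) ≤⟨ label-lipschitz (FoldedEdge L) height (λ e → height-close e) (reverseʷ w) ⟩
        n + height (toℕ (leaf (suc m) ≤-refl)) ≡⟨ cong (λ a → n + height a) (toℕ-fromℕ< (leaf< {suc m} ≤-refl)) ⟩
        n + height (2 * suc m)         ≡⟨ cong (n +_) (alternate-even _ _ (suc m)) ⟩
        n + pendant (m ∸ m)            ≡⟨ cong (λ t → n + pendant t) (n∸n≡0 m) ⟩
        n + 0                          ≡⟨ +-identityʳ n ⟩
        n                              ∎) ,
     λ x _ → near-leaf k<m+1 k≤c m≤k+c x) ,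
    m∸n≤m m k ,
    ≤-trans m≤k+c (≤-trans (+-monoˡ-≤ (m ∸ k) k≤c)
      (≤-reflexive (cong (m ∸ k +_) (sym (+-identityʳ (m ∸ k))))))
    where
    open ≤-Reasoning
    2k<m : k + k < m
    2k<m = ≰⇒> m≰2k
    k<m : k < m
    k<m = ≤-trans (s≤s (m≤m+n k k)) 2k<m
    k≤c : k ≤ m ∸ k
    k≤c = m+n≤o⇒m≤o∸n k (<⇒≤ 2k<m)
    m≤k+c : m ≤ k + (m ∸ k)
    m≤k+c = m≤n+m∸n m k

  floor-hasEcc : ∀ u → toℕ u ≢ 0 → 2 ∣ toℕ u →
                 ∃[ c ] (HasEcc F Everywhere u (c + 2) × c ≤ m × m ≤ 2 * c)
  floor-hasEcc u u≢0 (divides zero eq)    = ⊥-elim (u≢0 eq)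
  floor-hasEcc u u≢0 (divides (suc k) eq) =
    subst (λ x → ∃[ c ] (HasEcc F Everywhere x (c + 2) × c ≤ m × m ≤ 2 * c))
      (sym (label-view u x≡ (leaf< k<m+1))) (leaf-hasEcc k k<m+1)
    where
    x≡ : toℕ u ≡ 2 * suc k
    x≡ = trans eq (*-comm (suc k) 2)
    k<m+1 : suc k ≤ suc m
    k<m+1 = *-cancelˡ-≤ 2 (≤-pred (subst (_< L) x≡ (toℕ<n u)))

-- Disjoint unions

-- By `closed` no edge leaves the image, so walks from a vertex of the image pull back to `H` and
-- distances are preserved.
record ClosedEmbedding (H G : Graph) : Set where
  field
    φ         : Vertex H → Vertex G
    injective : ∀ {x y} → φ x ≡ φ y → x ≡ y
    hom       : ∀ {x y} → Adj H x y → Adj G (φ x) (φ y)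
    closed    : ∀ {x z} → Adj G (φ x) z → ∃[ y ] (z ≡ φ y × Adj H x y)

  embedʷ : ∀ {n x y} → Walk H n x y → Walk G n (φ x) (φ y)
  embedʷ []      = []
  embedʷ (e ∷ p) = hom e ∷ embedʷ p

  reflectʷ : ∀ {n x z} → Walk G n (φ x) z → ∃[ y ] (z ≡ φ y × Walk H n x y)
  reflectʷ [] = _ , refl , []
  reflectʷ (e ∷ p) with closed e
  ... | _ , refl , e′ with reflectʷ p
  ... | y , z≡ , p′ = y , z≡ , e′ ∷ p′

  embed-within : ∀ {d x y} → Within H d x y → Within G d (φ x) (φ y)
  embed-within (_ , n≤d , p) = _ , n≤d , embedʷ p

  embed-isDist : ∀ {d x y} → IsDist H x y d → IsDist G (φ x) (φ y) d
  embed-isDist {d} {x} {y} (p , d≤) = embedʷ p , λ n q →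
    let (z , eq , q′) = reflectʷ q in d≤ n (subst (Walk H n x) (sym (injective eq)) q′)

  module _ (C : Vertex G → Set) (image⊆C : ∀ x → C (φ x))
           (C⊆image : ∀ z → C z → ∃[ x ] z ≡ φ x) where

    embed-hasEcc : ∀ {u e} → HasEcc H Everywhere u e → HasEcc G C (φ u) e
    embed-hasEcc {u} {e} ((w , _ , d) , near) = (φ w , image⊆C w , embed-isDist d) , near′
      where
      near′ : ∀ z → C z → Within G e (φ u) z
      near′ z cz with C⊆image z cz
      ... | x , refl = embed-within (near x tt)

    embed-hasDiam : ∀ {d} → HasDiam H Everywhere d → HasDiam G C d
    embed-hasDiam {d} ((x , y , _ , _ , dist) , near) =
      (φ x , φ y , image⊆C x , image⊆C y , embed-isDist dist) , near′
      where
      near′ : ∀ z w → C z → C w → Within G d z w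
      near′ z w cz cw with C⊆image z cz | C⊆image w cw
      ... | x , refl | y , refl = embed-within (near x y tt tt)

module Union (H T : Graph) (n : ℕ) where

  G : Graph
  G = H ⊎ᴳ copies n T

  component : Vertex G → Fin (suc n)
  component (inj₁ _)       = zero
  component (inj₂ (i , _)) = suc i

  left-embedding : ClosedEmbedding H G
  left-embedding = record
    { φ         = inj₁
    ; injective = λ { refl → refl }
    ; hom       = λ e → ⊎.inj₁ e
    ; closed    = λ { (⊎.inj₁ e) → _ , refl , e }
    }

  copy-embedding : Fin n → ClosedEmbedding T G
  copy-embedding i = record
    { φ         = λ x → inj₂ (i , x)
    ; injective = λ { refl → refl }
    ; hom       = λ e → ⊎.inj₂ (refl , e)
    ; closed    = λ { (⊎.inj₂ (refl , e)) → _ , refl , e }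
    }

  module Left = ClosedEmbedding left-embedding
  module Copy (i : Fin n) = ClosedEmbedding (copy-embedding i)

  left-onto : ∀ z → component z ≡ zero → ∃[ x ] z ≡ inj₁ x
  left-onto (inj₁ x) _ = x , refl

  copy-onto : ∀ i z → component z ≡ suc i → ∃[ x ] z ≡ inj₂ (i , x)
  copy-onto i (inj₂ (_ , x)) refl = x , refl

  left-hasEcc : ∀ {u e} → HasEcc H Everywhere u e → HasEcc G (λ x → component x ≡ zero) (inj₁ u) e
  left-hasEcc = Left.embed-hasEcc _ (λ _ → refl) left-onto

  copy-hasEcc : ∀ i {u e} → HasEcc T Everywhere u e →
                HasEcc G (λ x → component x ≡ suc i) (inj₂ (i , u)) e
  copy-hasEcc i = Copy.embed-hasEcc i _ (λ _ → refl) (copy-onto i)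

  module _ {dH dT : ℕ} (diam-H : HasDiam H Everywhere dH) (diam-T : HasDiam T Everywhere dT) where

    diam : Fin (suc n) → ℕ
    diam zero    = dH
    diam (suc _) = dT

    hasDiam : ∀ i → HasDiam G (λ x → component x ≡ i) (diam i)
    hasDiam zero    = Left.embed-hasDiam _ (λ _ → refl) left-onto diam-H
    hasDiam (suc i) = Copy.embed-hasDiam i _ (λ _ → refl) (copy-onto i) diam-T

    components : Components G (suc n)
    components = record
      { comp       = component
      ; surjective = λ i → let (x , _ , cx , _) = proj₁ (hasDiam i) in x , λ { refl → cx }
      ; connected  = λ x y → mk⇔
          -- The diameter bound already supplies a walk between any two vertices with the same
          -- index.
          (λ eq → within⇒connected (proj₂ (hasDiam (component y)) x y eq refl))
          (λ { (_ , p) → component-walk p })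
      }
      where
      component-adj : ∀ {x y} → Adj G x y → component x ≡ component y
      component-adj (⊎.inj₁ _)          = refl
      component-adj (⊎.inj₂ (refl , _)) = refl

      component-walk : ∀ {k x y} → Walk G k x y → component x ≡ component y
      component-walk []      = refl
      component-walk (e ∷ p) = trans (component-adj e) (component-walk p)

    sum-diam : sum (tabulate diam) ≡ dH + n * dT
    sum-diam = cong (dH +_) (sum-const n dT)

-- Total diameter of the spine

module Spine (m k : ℕ) where

  private
    L : ℕ
    L = suc (2 * suc m)

    module S = Stacked (suc m) (s≤s z≤n)
    module F = Folded m
    module U = Union (𝓕 L) (𝓣 L) (suc k)

  MeanDiam : (u v : Vertex U.G) → u ≢ v → ℕ → Set
  MeanDiam u v u≢v t = IsMeanDiam (addEdge U.G u v u≢v) ((ℤ.+ t) ℚ./ suc k)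

  -- `x` is the sum of the two diameters lost and `y` the diameter gained; cancelling `x` determines
  -- the new total.
  meanDiam-total : ∀ {u v} (u≢v : u ≢ v) t x y →
    ∃[ s ] (MeanDiam u v u≢v s × s + x ≡ sum (tabulate (U.diam F.hasDiam S.hasDiam)) + y) →
    m + 2 + suc k * (suc m + 2) + y ≡ t + x → MeanDiam u v u≢v t
  meanDiam-total {u} {v} u≢v t x y (s , md , eq) total =
    subst (MeanDiam u v u≢v) (+-cancelʳ-≡ x s t
      (trans eq (trans (cong (_+ y) (U.sum-diam F.hasDiam S.hasDiam)) total))) md

  -- Two diameters `m + 3` give way to one of `2(m + 3) + 1`. The extra 1 raises the folded `m + 2`
  -- to `m + 3`, so the total is `2 + k` equal shares.
  stacked-stacked : ∀ i j x y (u≢v : inj₂ (i , x) ≢ inj₂ (j , y)) → i ≢ j → 2 ∣ toℕ x → 2 ∣ toℕ y →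
                    MeanDiam (inj₂ (i , x)) (inj₂ (j , y)) u≢v ((2 + k) * (3 + m))
  stacked-stacked i j x y u≢v i≢j ex ey =
    meanDiam-total u≢v ((2 + k) * (3 + m)) (d + d) (d + suc d)
      (Attach.isMeanDiam U.G _ _ u≢v
        (U.components F.hasDiam S.hasDiam) _ (U.hasDiam F.hasDiam S.hasDiam)
        (i≢j ∘ suc-injective)
        (U.copy-hasEcc i (S.leaf-hasEcc x ex)) (U.copy-hasEcc j (S.leaf-hasEcc y ey))
        (m≤m+n d (suc d)) (m≤m+n d (suc d)))
      (total k m)
    where
    d : ℕ
    d = suc m + 2
    total : ∀ k m → m + 2 + suc k * (suc m + 2) + (suc m + 2 + suc (suc m + 2)) ≡
                    (2 + k) * (3 + m) + (suc m + 2 + (suc m + 2))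
    total = solve-∀

  -- The joined diameter is `(c + 2) + (m + 3) + 1`; together with the `k` untouched stacked
  -- components this gives the stated total.
  FoldedBounds : (u v : Vertex U.G) → u ≢ v → Set
  FoldedBounds u v u≢v =
    ∃[ c ] (MeanDiam u v u≢v (suc k * (3 + m) + (3 + c)) × c ≤ m × m ≤ 2 * c)

  folded-stacked : ∀ i x y (u≢v : inj₁ x ≢ inj₂ (i , y)) → toℕ x ≢ 0 → 2 ∣ toℕ x → 2 ∣ toℕ y →
                   FoldedBounds (inj₁ x) (inj₂ (i , y)) u≢v
  folded-stacked i x y u≢v x≢0 ex ey =
    let (c , ecc , c≤m , m≤2c) = F.floor-hasEcc x x≢0 ex
        d = suc m + 2
    in c ,
       meanDiam-total u≢v (suc k * (3 + m) + (3 + c)) (m + 2 + d) (c + 2 + suc d)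
         (Attach.isMeanDiam U.G _ _ u≢v
           (U.components F.hasDiam S.hasDiam) _ (U.hasDiam F.hasDiam S.hasDiam)
           (λ ())
           (U.left-hasEcc ecc) (U.copy-hasEcc i (S.leaf-hasEcc y ey))
           (≤-trans (≤-trans (n≤1+n (m + 2)) (n≤1+n d)) (m≤n+m (suc d) (c + 2)))
           (≤-trans (n≤1+n d) (m≤n+m (suc d) (c + 2))))
         (total k m c) ,
       c≤m , m≤2c
    where
    total : ∀ k m c → m + 2 + suc k * (suc m + 2) + (c + 2 + suc (suc m + 2)) ≡
                      suc k * (3 + m) + (3 + c) + (m + 2 + (suc m + 2))
    total = solve-∀

  -- `addEdge` takes its endpoints in order, so the mirror image is a different graph and is
  -- computed separately.
  stacked-folded : ∀ i x y (u≢v : inj₂ (i , x) ≢ inj₁ y) → toℕ y ≢ 0 → 2 ∣ toℕ x → 2 ∣ toℕ y →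
                   FoldedBounds (inj₂ (i , x)) (inj₁ y) u≢v
  stacked-folded i x y u≢v y≢0 ex ey =
    let (c , ecc , c≤m , m≤2c) = F.floor-hasEcc y y≢0 ey
        d = suc m + 2
    in c ,
       meanDiam-total u≢v (suc k * (3 + m) + (3 + c)) (d + (m + 2)) (d + suc (c + 2))
         (Attach.isMeanDiam U.G _ _ u≢v
           (U.components F.hasDiam S.hasDiam) _ (U.hasDiam F.hasDiam S.hasDiam)
           (λ ())
           (U.copy-hasEcc i (S.leaf-hasEcc x ex)) (U.left-hasEcc ecc)
           (m≤m+n d (suc (c + 2)))
           (≤-trans (n≤1+n (m + 2)) (m≤m+n d (suc (c + 2)))))
         (total k m c) ,
       c≤m , m≤2c
    where
    total : ∀ k m c → m + 2 + suc k * (suc m + 2) + (suc m + 2 + suc (c + 2)) ≡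
                      suc k * (3 + m) + (3 + c) + (suc m + 2 + (m + 2))
    total = solve-∀

-- Arithmetic of the mean diameters

/-cross-≡ : ∀ a b c d .{{_ : NonZero c}} .{{_ : NonZero d}} → a * d ≡ b * c →
            (ℤ.+ a) ℚ./ c ≡ (ℤ.+ b) ℚ./ d
/-cross-≡ a b (suc c) (suc d) eq = ℚ.fromℚᵘ-cong {ℚᵘ.mkℚᵘ (ℤ.+ a) c} {ℚᵘ.mkℚᵘ (ℤ.+ b) d}
  (ℚᵘ.*≡* (trans (sym (ℤ.pos-* a (suc d))) (trans (cong ℤ.+_ eq) (ℤ.pos-* b (suc c)))))

/-cross-≤ : ∀ a b c d .{{_ : NonZero c}} .{{_ : NonZero d}} → a * d ≤ b * c →
            (ℤ.+ a) ℚ./ c ℚ.≤ (ℤ.+ b) ℚ./ d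
/-cross-≤ a b (suc c) (suc d) le = ℚ.toℚᵘ-cancel-≤
  (ℚᵘ.≤-respˡ-≃ (ℚᵘ.≃-sym (ℚ.toℚᵘ-fromℚᵘ (ℚᵘ.mkℚᵘ (ℤ.+ a) c)))
    (ℚᵘ.≤-respʳ-≃ (ℚᵘ.≃-sym (ℚ.toℚᵘ-fromℚᵘ (ℚᵘ.mkℚᵘ (ℤ.+ b) d)))
      (ℚᵘ.*≤* (subst₂ ℤ._≤_ (ℤ.pos-* a (suc d)) (ℤ.pos-* b (suc c)) (ℤ.+≤+ le)))))

module Values (m k : ℕ) where

  private
    L h : ℕ
    L = suc (2 * suc m)
    h = (2 * suc k + 1) * L

    denominator : 2 * (h ∸ L) ≡ 2 * (2 * suc k * L)
    denominator = cong (2 *_) (trans (cong (_∸ L) (expand (suc k) L)) (m+n∸n≡m (2 * suc k * L) L))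
      where
      expand : ∀ n l → (2 * n + 1) * l ≡ 2 * n * l + l
      expand = solve-∀

    -- With `n = suc k`: `L + 3 = 2(m + 3)`, `h + L = 2(n + 1)L` and `h - L = 2nL`, so the upper
    -- value is `(n + 1)(m + 3) / n`.
    upper-cross : (2 + k) * (3 + m) * (2 * (h ∸ L)) ≡ (L + 3) * (h + L) * suc k
    upper-cross = trans (cong ((2 + k) * (3 + m) *_) denominator) (identity k m)
      where
      identity : ∀ k m → (2 + k) * (3 + m) * (2 * (2 * suc k * suc (2 * suc m))) ≡
        (suc (2 * suc m) + 3) * ((2 * suc k + 1) * suc (2 * suc m) + suc (2 * suc m)) * suc k
      identity = solve-∀

  module _ .{{_ : NonZero (2 * (h ∸ L))}} where

    upperValue≡ : (ℤ.+ ((2 + k) * (3 + m))) ℚ./ suc k ≡ upperValue h L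
    upperValue≡ = /-cross-≡ _ _ (suc k) (2 * (h ∸ L)) upper-cross

    ≤upperValue : ∀ {c} → c ≤ m → (ℤ.+ (suc k * (3 + m) + (3 + c))) ℚ./ suc k ℚ.≤ upperValue h L
    ≤upperValue {c} c≤m = /-cross-≤ _ _ (suc k) (2 * (h ∸ L)) (begin
      (suc k * (3 + m) + (3 + c)) * (2 * (h ∸ L))
        ≤⟨ *-monoˡ-≤ (2 * (h ∸ L)) (+-monoʳ-≤ (suc k * (3 + m)) (+-monoʳ-≤ 3 c≤m)) ⟩
      (suc k * (3 + m) + (3 + m)) * (2 * (h ∸ L))
        ≡⟨ cong (_* (2 * (h ∸ L))) (+-comm (suc k * (3 + m)) (3 + m)) ⟩
      (2 + k) * (3 + m) * (2 * (h ∸ L))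
        ≡⟨ upper-cross ⟩
      (L + 3) * (h + L) * suc k ∎)
      where open ≤-Reasoning

    -- With `n = suc k` the numerator is `L(4n(m + 3) + 12 + 2m)` and the denominator `4nL`, so the
    -- lower value is the mean at `c = m / 2`.
    lowerValue≤ : ∀ {c} → m ≤ 2 * c → lowerValue h L ℚ.≤ (ℤ.+ (suc k * (3 + m) + (3 + c))) ℚ./ suc k
    lowerValue≤ {c} m≤2c = /-cross-≤ _ _ (2 * (h ∸ L)) (suc k) (begin
      (h * L + 3 * h + 6 * L) * suc k
        ≡⟨ before k m ⟩
      suc k * L * (4 * suc k * (3 + m) + 12 + 2 * m)
        ≤⟨ *-monoʳ-≤ (suc k * L) (+-monoʳ-≤ (4 * suc k * (3 + m) + 12) (*-monoʳ-≤ 2 m≤2c)) ⟩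
      suc k * L * (4 * suc k * (3 + m) + 12 + 2 * (2 * c))
        ≡⟨ after (suc k) L m c ⟩
      (suc k * (3 + m) + (3 + c)) * (2 * (2 * suc k * L))
        ≡⟨ cong ((suc k * (3 + m) + (3 + c)) *_) (sym denominator) ⟩
      (suc k * (3 + m) + (3 + c)) * (2 * (h ∸ L)) ∎)
      where
      open ≤-Reasoning
      before : ∀ k m → ((2 * suc k + 1) * suc (2 * suc m) * suc (2 * suc m)
                 + 3 * ((2 * suc k + 1) * suc (2 * suc m)) + 6 * suc (2 * suc m)) * suc k ≡
               suc k * suc (2 * suc m) * (4 * suc k * (3 + m) + 12 + 2 * m)
      before = solve-∀
      after : ∀ n l m c → n * l * (4 * n * (3 + m) + 12 + 2 * (2 * c)) ≡
              (n * (3 + m) + (3 + c)) * (2 * (2 * n * l))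
      after = solve-∀

-- Parity of the class number and of the order

even-not-odd : ∀ a → (2 * a) % 2 ≢ 1
even-not-odd a eq with trans (sym eq) (trans (cong (_% 2) (*-comm 2 a)) (m*n%n≡0 a 2))
... | ()

odd-≥3 : ∀ L → L % 2 ≡ 1 → 3 ≤ L → ∃[ m ] L ≡ suc (2 * suc m)
odd-≥3 L L-odd 3≤L with even-or-odd L
... | k , inj₁ refl     = ⊥-elim (even-not-odd k L-odd)
odd-≥3 L L-odd (s≤s ()) | zero , inj₂ refl
... | suc m , inj₂ refl = m , +-comm (2 * suc m) 1

-- An even quotient would make `h` even. As `h / L` is odd, the halving in `stackedCount` is exact.
odd-quotient : ∀ h L .{{_ : NonZero L}} → h % 2 ≡ 1 → L ∣ h →
               h ≡ (2 * stackedCount h L + 1) * L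
odd-quotient h L h-odd (divides q refl) with even-or-odd q
... | n , inj₁ refl = ⊥-elim (even-not-odd (n * L) (trans (cong (_% 2) (sym (*-assoc 2 n L))) h-odd))
... | n , inj₂ refl = cong (λ k → (2 * k + 1) * L) (sym count)
  where
  count : stackedCount ((2 * n + 1) * L) L ≡ n
  count = trans (/-congˡ (trans (cong (_∸ 1) (m*n/n≡m (2 * n + 1) L))
                  (trans (m+n∸n≡m (2 * n) 1) (*-comm 2 n)))) (m*n/n≡m n 2)

inhabited⇒suc : ∀ {n} → Fin n → ∃[ k ] n ≡ suc k
inhabited⇒suc {suc k} _ = k , refl

module _ (N h L : ℕ) .{{_ : NonZero (2 * (h ∸ L))}} where

  FoldedAttachment : (u v : Vertex (𝓕 L ⊎ᴳ copies N (𝓣 L))) → u ≢ v → Set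
  FoldedAttachment u v u≢v = ∃[ q ] (IsMeanDiam (addEdge (𝓕 L ⊎ᴳ copies N (𝓣 L)) u v u≢v) q ×
                                     lowerValue h L ℚ.≤ q × q ℚ.≤ upperValue h L)

-- N stands for stackedCount h L, which is not a constructor form to match on.
attach-stacked : ∀ {m k N h L} .{{_ : NonZero (2 * (h ∸ L))}} →
  L ≡ suc (2 * suc m) → N ≡ suc k → h ≡ (2 * N + 1) * L →
  ∀ i j x y (u≢v : inj₂ (i , x) ≢ inj₂ (j , y)) → i ≢ j → 2 ∣ toℕ x → 2 ∣ toℕ y →
  IsMeanDiam (addEdge (𝓕 L ⊎ᴳ copies N (𝓣 L)) (inj₂ (i , x)) (inj₂ (j , y)) u≢v) (upperValue h L)
attach-stacked {m} {k} refl refl refl i j x y u≢v i≢j ex ey =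
  subst (IsMeanDiam _) (Values.upperValue≡ m k) (Spine.stacked-stacked m k i j x y u≢v i≢j ex ey)

attach-folded : ∀ {m k N h L} .{{_ : NonZero (2 * (h ∸ L))}} →
  L ≡ suc (2 * suc m) → N ≡ suc k → h ≡ (2 * N + 1) * L →
  ∀ i x y (u≢v : inj₁ x ≢ inj₂ (i , y)) → toℕ x ≢ 0 → 2 ∣ toℕ x → 2 ∣ toℕ y →
  FoldedAttachment N h L (inj₁ x) (inj₂ (i , y)) u≢v
attach-folded {m} {k} refl refl refl i x y u≢v x≢0 ex ey =
  let (c , md , c≤m , m≤2c) = Spine.folded-stacked m k i x y u≢v x≢0 ex ey
  in _ , md , Values.lowerValue≤ m k m≤2c , Values.≤upperValue m k c≤m

attach-folded′ : ∀ {m k N h L} .{{_ : NonZero (2 * (h ∸ L))}} →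
  L ≡ suc (2 * suc m) → N ≡ suc k → h ≡ (2 * N + 1) * L →
  ∀ i x y (u≢v : inj₂ (i , x) ≢ inj₁ y) → toℕ y ≢ 0 → 2 ∣ toℕ x → 2 ∣ toℕ y →
  FoldedAttachment N h L (inj₂ (i , x)) (inj₁ y) u≢v
attach-folded′ {m} {k} refl refl refl i x y u≢v y≢0 ex ey =
  let (c , md , c≤m , m≤2c) = Spine.stacked-folded m k i x y u≢v y≢0 ex ey
  in _ , md , Values.lowerValue≤ m k m≤2c , Values.≤upperValue m k c≤m

mainTheorem14 : (p h L : ℕ) .{{_ : NonZero L}} →
    Prime p → p % 120 ≡ 71 ⊎ p % 120 ≡ 119 →
    IsClassNumber p h → IsOrderOfPrimeAbove2 p L →
    h % 2 ≡ 1 → L % 2 ≡ 1 → 3 ≤ L → L ∣ h →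
    (u v : Vertex (Γ h L)) → Floor u → Floor v → (u≢v : u ≢ v) →
    ¬ Connected (Γ h L) u v →
    (∀ i j → i ≢ j → InStacked i u → InStacked j v →
    IsMeanDiam (spine h L u v u≢v) (upperValue h L {{stacked⇒nonZero h L i}})) ×
    (∀ i → (InFolded u × InStacked i v) ⊎ (InStacked i u × InFolded v) →
    ∃[ q ] (IsMeanDiam (spine h L u v u≢v) q ×
    lowerValue h L {{stacked⇒nonZero h L i}} ℚ.≤ q ×
    q ℚ.≤ upperValue h L {{stacked⇒nonZero h L i}}))
mainTheorem14 p h L _ _ _ _ h-odd L-odd 3≤L L∣h u v floor-u floor-v u≢v _ =
  both-stacked u v floor-u floor-v u≢v , folded-and-stacked u v floor-u floor-v u≢v
  where
  L≡ = proj₂ (odd-≥3 L L-odd 3≤L)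
  h≡ = odd-quotient h L h-odd L∣h

  both-stacked : (u v : Vertex (Γ h L)) → Floor u → Floor v → (u≢v : u ≢ v) →
    ∀ i j → i ≢ j → InStacked i u → InStacked j v →
    IsMeanDiam (spine h L u v u≢v) (upperValue h L {{stacked⇒nonZero h L i}})
  both-stacked _ _ (stacked ex) (stacked ey) u≢v i j i≢j (stacked x) (stacked y) =
    -- The index `i` itself shows that there is a stacked component, so the count is a successor.
    attach-stacked {{stacked⇒nonZero h L i}} L≡ (proj₂ (inhabited⇒suc i)) h≡ i j x y u≢v i≢j ex ey

  folded-and-stacked : (u v : Vertex (Γ h L)) → Floor u → Floor v → (u≢v : u ≢ v) →
    ∀ i → (InFolded u × InStacked i v) ⊎ (InStacked i u × InFolded v) →
    ∃[ q ] (IsMeanDiam (spine h L u v u≢v) q ×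
    lowerValue h L {{stacked⇒nonZero h L i}} ℚ.≤ q ×
    q ℚ.≤ upperValue h L {{stacked⇒nonZero h L i}})
  folded-and-stacked _ _ (folded x≢0 ex) (stacked ey) u≢v i (inj₁ (folded x , stacked y)) =
    attach-folded {{stacked⇒nonZero h L i}} L≡ (proj₂ (inhabited⇒suc i)) h≡ i x y u≢v x≢0 ex ey
  folded-and-stacked _ _ (stacked ex) (folded y≢0 ey) u≢v i (inj₂ (stacked x , folded y)) =
    attach-folded′ {{stacked⇒nonZero h L i}} L≡ (proj₂ (inhabited⇒suc i)) h≡ i x y u≢v y≢0 ex ey
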